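{- Let $G$ be an OTG with $n\geq 5$ vertices, let $X$ be a minimum $H$-force set of $G$, and let $C_w(G)$ be the weak closure of $G$. Then (1) $h(G)\in\{n-2,\ \tfrac{n}{2},\ n\}$; and (2) if $h(G)=n-2$ then $X=V(G)\setminus\{x,y\}$, where $x,y\in V(G)$ are vertices with $d_{C_w(G)}(x)=d_{C_w(G)}(y)=n-1$; if $h(G)=\tfrac{n}{2}$ then $X=S$, where $S$ is a largest independent set of $C_w(G)$; and if $h(G)=n$ then $X=V(G)$.
   Context: All graphs are finite and simple. A graph $G$ with $n$ vertices is called an OTG if $d(u)+d(v)\geq n$ for every pair of distinct nonadjacent vertices $u,v$ of $G$ (such a graph with $n\ge3$ is Hamiltonian by Ore's theorem). For $X\subseteq V(G)$, an $X$-cycle is a cycle of $G$ containing all vertices of $X$. For a Hamiltonian graph $G$, a nonempty $X\subseteq V(G)$ is an $H$-force set if every $X$-cycle of $G$ is Hamiltonian; $h(G)$ is the smallest cardinality of an $H$-force set; a minimum $H$-force set is an $H$-force set of cardinality $h(G)$. The weak closure $C_w(G)$ of an OTG $G$ on $n$ vertices is the graph obtained from $G$ by repeatedly joining a pair of nonadjacent vertices whose degree sum (in the current graph) is at least $n+1$, until no such pair remains; it is well defined (independent of the order of additions). A largest independent set is an independent set of maximum cardinality. -}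

module Defs where

open import Data.Nat using (ℕ; zero; suc; _+_; _*_; _∸_; _≤_; _<_)
open import Data.Bool using (Bool; true; false)
open import Data.Fin using (Fin)
open import Data.Fin.Subset using (Subset; Nonempty; ∣_∣) renaming (_∈_ to _∈ₛ_)
open import Data.Vec using (tabulate)
open import Data.List using (List; []; _∷_; length)
open import Data.List.Membership.Propositional using () renaming (_∈_ to _∈ₗ_)
open import Data.List.Relation.Unary.Unique.Propositional using (Unique)
open import Data.Product using (Σ; ∃; _×_; _,_)
open import Data.Sum using (_⊎_)
open import Data.Unit using (⊤)
open import Data.Empty using (⊥)
open import Relation.Nullary using (¬_)
open import Relation.Binary.PropositionalEquality using (_≡_; _≢_)
open import Relation.Binary.Construct.Closure.ReflexiveTransitive using (Star)

record Graph (n : ℕ) : Set where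
  field
    adj    : Fin n → Fin n → Bool
    sym    : ∀ u v → adj u v ≡ adj v u
    irrefl : ∀ u → adj u u ≡ false
open Graph public

deg : ∀ {n} → Graph n → Fin n → ℕ
deg G u = ∣ tabulate (adj G u) ∣

OTG : ∀ {n} → Graph n → Set
OTG {n} G = ∀ u v → u ≢ v → adj G u v ≡ false → n ≤ deg G u + deg G v

Path : ∀ {n} → Graph n → Fin n → List (Fin n) → Set
Path G x [] = ⊤
Path G x (y ∷ ys) = adj G x y ≡ true × Path G y ys

lastOf : ∀ {n} → Fin n → List (Fin n) → Fin n
lastOf x [] = x
lastOf x (y ∷ ys) = lastOf y ys

IsCycle : ∀ {n} → Graph n → List (Fin n) → Set
IsCycle G [] = ⊥
IsCycle G (x ∷ xs) =
  3 ≤ length (x ∷ xs) × Unique (x ∷ xs) × Path G x xs × adj G (lastOf x xs) x ≡ true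

IsHamCycle : ∀ {n} → Graph n → List (Fin n) → Set
IsHamCycle G c = IsCycle G c × (∀ v → v ∈ₗ c)

IsXCycle : ∀ {n} → Graph n → Subset n → List (Fin n) → Set
IsXCycle G X c = IsCycle G c × (∀ x → x ∈ₛ X → x ∈ₗ c)

HForce : ∀ {n} → Graph n → Subset n → Set
HForce G X = Nonempty X × (∀ c → IsXCycle G X c → IsHamCycle G c)

-- minimum H-force set (its cardinality is h(G))
MinHForce : ∀ {n} → Graph n → Subset n → Set
MinHForce G X = HForce G X × (∀ Y → HForce G Y → ∣ X ∣ ≤ ∣ Y ∣)

EdgeOrNew : ∀ {n} → Graph n → Fin n → Fin n → Fin n → Fin n → Set
EdgeOrNew G u v a b = adj G a b ≡ true ⊎ ((a ≡ u × b ≡ v) ⊎ (a ≡ v × b ≡ u))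

AddEdge : ∀ {n} → Graph n → Fin n → Fin n → Graph n → Set
AddEdge G u v G' = ∀ a b →
  ((adj G' a b ≡ true) → EdgeOrNew G u v a b) × (EdgeOrNew G u v a b → adj G' a b ≡ true)

WStep : ∀ {n} → Graph n → Graph n → Set
WStep {n} G G' = Σ (Fin n) λ u → Σ (Fin n) λ v →
  u ≢ v × adj G u v ≡ false × suc n ≤ deg G u + deg G v × AddEdge G u v G'

WClosed : ∀ {n} → Graph n → Set
WClosed {n} H = ∀ u v → u ≢ v → adj H u v ≡ false → deg H u + deg H v < suc n

IsWeakClosure : ∀ {n} → Graph n → Graph n → Set
IsWeakClosure G H = Star WStep G H × WClosed H

Independent : ∀ {n} → Graph n → Subset n → Set
Independent G S = ∀ u v → u ∈ₛ S → v ∈ₛ S → adj G u v ≡ false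

LargestIndependent : ∀ {n} → Graph n → Subset n → Set
LargestIndependent G S = Independent G S × (∀ T → Independent G T → ∣ T ∣ ≤ ∣ S ∣)

module Submission where

-- A vertex v lies in every H-force set as soon as G − v is Hamiltonian, so everything rests on an
-- Ore-type theorem: a graph on N ≥ 3 vertices in which nonadjacent degree sums are at least N − 1 is
-- Hamiltonian, or has a cut vertex, or has an independent set of (N + 1)/2 vertices.  It is proved by
-- minimising the number of consecutive nonadjacent pairs ("gaps") in a cyclic arrangement of the
-- vertices.  At a gap (b, a), if no crossing chord pair removes the gap, each consecutive pair (u, v)
-- has exactly one of b ~ u and a ~ v; then either the two neighbourhoods meet in one vertex, a cut
-- vertex unless some chord removes a gap, or a vertex w can be bypassed; then w together with the
-- successors of its neighbours is independent, unless a gap can be removed.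
-- Applied to G − v, the exceptional outcomes are a cut pair {v, x} or an independent set of n/2
-- vertices.  In both, the nonadjacent pairs concerned have degree sum at most n, so they remain
-- nonadjacent in the weak closure, and they determine the minimum H-force set.

open import Defs
open import Data.Bool using (Bool; true; false; if_then_else_; not)
open import Data.Bool.Properties using () renaming (_≟_ to _≟ᵇ_)
open import Data.Empty using (⊥; ⊥-elim)
open import Data.Fin as Fin using (Fin; _≟_; fromℕ<)
open import Data.Fin.Properties using () renaming (any? to anyFin?)
open import Data.Fin.Subset using (Subset; ∣_∣; _∈_; _∉_; _⊆_; ∁; ⁅_⁆; _∪_; ⊤)
open import Data.Fin.Subset.Properties
  using (_∈?_; p⊆q⇒∣p∣≤∣q∣; p⊂q⇒∣p∣<∣q∣; ∣∁p∣≡n∸∣p∣; ∣⁅x⁆∣≡1; ∣⊤∣≡n; ∣p∣≤n; x∉p⇒x∈∁p; x∈∁p⇒x∉p;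
         x∈⁅x⁆; p⊆p∪q; q⊆p∪q; ⊆-antisym; ∈⊤)
open import Data.List using (List; []; _∷_; _++_; length; reverse; _∷ʳ_; allFin) renaming (tabulate to tabulateₗ)
open import Data.List.Properties using (++-assoc; ++-identityʳ; length-++; unfold-reverse; length-tabulate)
import Data.List.Membership.DecPropositional as DecMembership
open import Data.List.Membership.Propositional using () renaming (_∈_ to _∈ₗ_)
open import Data.List.Membership.Propositional.Properties using (∈-allFin; ∈-++⁺ˡ; ∈-++⁺ʳ; ∈-++⁻; ∈-∃++)
open import Data.List.Relation.Binary.Permutation.Propositional
  using (_↭_; refl; prep; swap; trans; ↭-sym; ↭-trans; ↭-refl; ↭-reflexive; ↭⇒↭ₛ; module PermutationReasoning)
open import Data.List.Relation.Binary.Permutation.Propositional.Properties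
  using (↭-length; ∈-resp-↭; ++-comm; ++⁺ˡ; shift; ↭-reverse)
import Data.List.Relation.Binary.Permutation.Setoid.Properties as Permutationₛ
import Data.List.Relation.Unary.All as All
open import Data.List.Relation.Unary.All using (All; []; _∷_)
open import Data.List.Relation.Unary.All.Properties using (All¬⇒¬Any; ¬Any⇒All¬)
open import Data.List.Relation.Unary.AllPairs using (AllPairs; []; _∷_)
open import Data.List.Relation.Unary.Any using (here; there; any?)
import Data.List.Relation.Unary.Linked as Linked
open import Data.List.Relation.Unary.Linked using (Linked; []; [-]; _∷_)
open import Data.List.Relation.Unary.Unique.Propositional using (Unique)
open import Data.List.Relation.Unary.Unique.Propositional.Properties using (allFin⁺)
open import Data.Nat using (ℕ; zero; suc; _+_; _*_; _∸_; _≤_; _<_; z≤n; s≤s; s≤s⁻¹)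
open import Data.Nat.Properties hiding (_≟_)
open import Data.Nat.Tactic.RingSolver using (solve-∀)
open import Data.Product using (Σ; ∃; _×_; _,_; proj₁; proj₂)
open import Data.Sum using (_⊎_; inj₁; inj₂)
import Data.Sum as Sum
open import Data.Unit using (tt)
open import Data.Vec as Vec using (tabulate; lookup)
open import Data.Vec.Properties using (lookup∘tabulate; lookup⇒[]=; []=⇒lookup; tabulate∘lookup)
open import Function using (_∘_; id)
open import Function.Bundles using (_⇔_; mk⇔)
open import Relation.Binary.Construct.Closure.ReflexiveTransitive using (Star; ε; _◅_)
open import Relation.Binary.PropositionalEquality
  using (_≡_; _≢_; refl; cong; cong₂; subst; subst₂; setoid; module ≡-Reasoning)
  renaming (sym to ≡-sym; trans to ≡-trans)
open import Relation.Nullary using (¬_; Dec; yes; no; does; contradiction)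
open import Relation.Nullary.Decidable using (_×-dec_; ¬?; dec-true; dec-false; decidable-stable)

-- Counting along lists and linear arithmetic.

bit : Bool → ℕ
bit b = if b then 1 else 0

bit≤1 : ∀ b → bit b ≤ 1
bit≤1 true  = ≤-refl
bit≤1 false = z≤n

-- Linear arithmetic: the remaining identity is one for the ring solver.
≤-by : ∀ {a b x y} e → x ≤ y → a + y + e ≡ b + x → a ≤ b
≤-by {a} {b} {x} {y} e x≤y eq = +-cancelʳ-≤ y a b (begin
  a + y      ≤⟨ m≤m+n (a + y) e ⟩
  a + y + e  ≡⟨ eq ⟩
  b + x      ≤⟨ +-monoʳ-≤ b x≤y ⟩
  b + y      ∎)
  where open ≤-Reasoning

module _ {A : Set} where

  count : (A → Bool) → List A → ℕ
  count f []       = 0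
  count f (x ∷ xs) = bit (f x) + count f xs

  count-++ : ∀ f xs ys → count f (xs ++ ys) ≡ count f xs + count f ys
  count-++ f []       ys = refl
  count-++ f (x ∷ xs) ys = ≡-trans (cong (bit (f x) +_) (count-++ f xs ys))
                                   (≡-sym (+-assoc (bit (f x)) _ _))

  count-↭ : ∀ f {xs ys} → xs ↭ ys → count f xs ≡ count f ys
  count-↭ f refl = refl
  count-↭ f (prep x p) = cong (bit (f x) +_) (count-↭ f p)
  count-↭ f (swap {xs} {ys} x y p) =
    ≡-trans (cong (λ k → bit (f x) + (bit (f y) + k)) (count-↭ f p)) (exch (bit (f x)) (bit (f y)) _)
    where
    exch : ∀ a b c → a + (b + c) ≡ b + (a + c)
    exch = solve-∀
  count-↭ f (trans p q) = ≡-trans (count-↭ f p) (count-↭ f q)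

  count≤length : ∀ f xs → count f xs ≤ length xs
  count≤length f []       = z≤n
  count≤length f (x ∷ xs) = +-mono-≤ (bit≤1 (f x)) (count≤length f xs)

  -- A linked relation that reads only the first vertex of a pair speaks of all entries but the
  -- last; one that reads only the second, as in `Linked-tail`, of all but the first.
  Linked-init : ∀ {P : A → Set} xs {y} → Linked (λ u _ → P u) (xs ∷ʳ y) → All P xs
  Linked-init []            _        = []
  Linked-init (x ∷ [])      (p ∷ _)  = p ∷ []
  Linked-init (x ∷ x′ ∷ xs) (p ∷ ps) = p ∷ Linked-init (x′ ∷ xs) ps

  Linked-tail : ∀ {P : A → Set} {x} xs → Linked (λ _ v → P v) (x ∷ xs) → All P xs
  Linked-tail []       _        = []
  Linked-tail (x ∷ xs) (p ∷ ps) = p ∷ Linked-tail xs ps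

  Clash Exact : (f h : A → Bool) → A → A → Set
  Clash f h u v = f u ≡ true × h v ≡ true
  Exact f h u v = h v ≡ not (f u)

-- Routes: vertex sequences with their gaps counted.

module _ {n} (G : Graph n) where

  gap : Fin n → Fin n → ℕ
  gap u v = bit (not (adj G u v))

  gap-sym : ∀ u v → gap u v ≡ gap v u
  gap-sym u v = cong (λ b → bit (not b)) (Graph.sym G u v)

  gap≡0 : ∀ {u v} → adj G u v ≡ true → gap u v ≡ 0
  gap≡0 e = cong (λ b → bit (not b)) e

  -- Route x y l k: the list l begins with x, ends with y and has k consecutive nonadjacent pairs;
  -- its entries need not be adjacent.
  data Route : Fin n → Fin n → List (Fin n) → ℕ → Set where
    stop : ∀ x → Route x x (x ∷ []) 0
    step : ∀ x {y z l k} → Route y z l k → Route x z (x ∷ l) (gap x y + k)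

  cast : ∀ {x y l m j k} → l ≡ m → j ≡ k → Route x y l j → Route x y m k
  cast refl refl r = r

  append : ∀ {x y u v l m j k} → Route x y l j → Route u v m k → Route x v (l ++ m) (j + (gap y u + k))
  append (stop x) s = step x s
  append {y = y} {u} {k = k} (step x {y = x′} {k = j} r) s =
    cast refl (≡-sym (+-assoc (gap x x′) j _)) (step x (append r s))

  -- The shared vertex `y` already ends `l`, so only `m` is appended.
  glue : ∀ {x y z l m j k} → Route x y l j → Route y z (y ∷ m) k → Route x z (l ++ m) (j + k)
  glue (stop x) s = s
  glue (step x {y = x′} {k = j} r) s = cast refl (≡-sym (+-assoc (gap x x′) j _)) (step x (glue r s))

  rev : ∀ {x y l k} → Route x y l k → Route y x (reverse l) k
  rev (stop x) = stop x
  rev (step x {y = x′} {l = l} {k = k} r) =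
    cast (≡-sym (unfold-reverse x l)) (lem (gap x x′) k (gap-sym x′ x)) (append (rev r) (stop x))
    where
    lem : ∀ g k {g′} → g′ ≡ g → k + (g′ + 0) ≡ g + k
    lem g k refl = ≡-trans (cong (k +_) (+-identityʳ g)) (+-comm k g)

  route-∷ : ∀ {x y l k} → Route x y l k → ∃ λ m → l ≡ x ∷ m
  route-∷ (stop x)   = [] , refl
  route-∷ (step x _) = _ , refl

  route-∷ʳ : ∀ {x y l k} → Route x y l k → ∃ λ m → l ≡ m ∷ʳ y
  route-∷ʳ (stop x) = [] , refl
  route-∷ʳ (step x r) with route-∷ʳ r
  ... | m , refl = x ∷ m , refl

  record Split (R : Fin n → Fin n → Set) (x z : Fin n) (l : List (Fin n)) (k : ℕ) : Set where
    constructor split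
    field
      {u v}   : Fin n
      {l₁ l₂} : List (Fin n)
      {k₁ k₂} : ℕ
      left    : Route x u l₁ k₁
      right   : Route v z l₂ k₂
      l≡      : l ≡ l₁ ++ l₂
      k≡      : k ≡ k₁ + (gap u v + k₂)
      holds   : R u v

  search : ∀ {R : Fin n → Fin n → Set} → (∀ u v → Dec (R u v)) → ∀ {x z l k} → Route x z l k →
           Split R x z l k ⊎ Linked (λ u v → ¬ R u v) l
  search R? (stop x) = inj₂ [-]
  search R? (step x {y = y} r) with R? x y | search R? r | route-∷ r
  ... | yes p | _ | _ = inj₁ (split (stop x) r refl refl p)
  ... | no ¬p | inj₁ (split {u} {v} {k₁ = k₁} {k₂} left right refl refl p) | _ =
    inj₁ (split (step x left) right refl (≡-sym (+-assoc (gap x y) k₁ _)) p)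
  ... | no ¬p | inj₂ lk | _ , refl = inj₂ (¬p ∷ lk)

  split-linked : ∀ {R Q : Fin n → Fin n → Set} {x z l k} → (s : Split R x z l k) → Linked Q l →
                 Q (Split.u s) (Split.v s)
  split-linked (split left right refl refl _) = go left right
    where
    go : ∀ {Q : Fin n → Fin n → Set} {x u v z l m j k} → Route x u l j → Route v z m k → Linked Q (l ++ m) → Q u v
    go (stop _)  r lk with route-∷ r
    go (stop _)  r (q ∷ _) | _ , refl = q
    go (step _ l) r lk with route-∷ l
    go (step _ l) r (_ ∷ lk) | _ , refl = go l r lk

  -- Summing `bit (f u) + bit (h v)` over consecutive pairs gives both counts without the terms of
  -- `f z` and `h x`. Each of the `length l` minus one pairs contributes at most one; equality
  -- throughout is `Exact`.
  no-clash-count : ∀ f h {x z l k} → Route x z l k → Linked (λ u v → ¬ Clash f h u v) l →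
                   Linked (Exact f h) l
                     × suc (count f l + count h l) ≡ length l + (bit (f z) + bit (h x))
                   ⊎ suc (suc (count f l + count h l)) ≤ length l + (bit (f z) + bit (h x))
  no-clash-count f h (stop x) [-] = inj₁ ([-] , lem (bit (f x)) (bit (h x)))
    where
    lem : ∀ a b → suc (a + 0 + (b + 0)) ≡ 1 + (a + b)
    lem = solve-∀
  no-clash-count f h (step x r) lk with route-∷ r
  no-clash-count f h {z = z} (step x {y} {l = l} r) (¬c ∷ lk) | _ , refl =
    extend (no-clash-count f h r lk) (pair (f x) (h y) ¬c)
    where
    pair : ∀ p q → ¬ (p ≡ true × q ≡ true) → (q ≡ not p × bit p + bit q ≡ 1) ⊎ (bit p + bit q ≤ 0)
    pair true  true  c = contradiction (refl , refl) c
    pair true  false _ = inj₁ (refl , refl)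
    pair false true  _ = inj₁ (refl , refl)
    pair false false _ = inj₂ z≤n

    exact : ∀ p q a b c d e → p + q ≡ 1 → suc (a + b) ≡ c + (d + q) → suc (p + a + (e + b)) ≡ suc c + (d + e)
    exact p q a b c d e e₁ e₂ = +-cancelʳ-≡ q _ _
      (≡-trans (lhs p q a b e) (≡-trans (cong₂ (λ s t → s + t + e) e₁ e₂) (rhs q c d e)))
      where
      lhs : ∀ p q a b e → suc (p + a + (e + b)) + q ≡ p + q + suc (a + b) + e
      lhs = solve-∀
      rhs : ∀ q c d e → 1 + (c + (d + q)) + e ≡ suc c + (d + e) + q
      rhs = solve-∀

    deficient : ∀ p q a b c d e → p + q + suc (a + b) ≤ c + (d + q) → suc (suc (p + a + (e + b))) ≤ suc c + (d + e)
    deficient p q a b c d e le = ≤-by 0 le (lem p q a b c d e)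
      where
      lem : ∀ p q a b c d e → suc (suc (p + a + (e + b))) + (c + (d + q)) + 0 ≡ suc c + (d + e) + (p + q + suc (a + b))
      lem = solve-∀

    extend : Linked (Exact f h) l × suc (count f l + count h l) ≡ length l + (bit (f z) + bit (h y))
               ⊎ suc (suc (count f l + count h l)) ≤ length l + (bit (f z) + bit (h y)) →
             (h y ≡ not (f x) × bit (f x) + bit (h y) ≡ 1) ⊎ (bit (f x) + bit (h y) ≤ 0) →
             Linked (Exact f h) (x ∷ l) ×
               suc (count f (x ∷ l) + count h (x ∷ l)) ≡ length (x ∷ l) + (bit (f z) + bit (h x))
             ⊎ suc (suc (count f (x ∷ l) + count h (x ∷ l))) ≤ length (x ∷ l) + (bit (f z) + bit (h x))
    extend (inj₁ (ex , e)) (inj₁ (hy , pq)) =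
      inj₁ (hy ∷ ex , exact (bit (f x)) _ (count f l) _ (length l) (bit (f z)) _ pq e)
    extend (inj₁ (ex , e)) (inj₂ pq) =
      inj₂ (deficient (bit (f x)) _ (count f l) _ (length l) (bit (f z)) _ (+-mono-≤ pq (≤-reflexive e)))
    extend (inj₂ e) (inj₁ (_ , pq)) =
      inj₂ (deficient (bit (f x)) _ (count f l) _ (length l) (bit (f z)) _ (≤-trans (+-monoˡ-≤ _ (≤-reflexive pq)) e))
    extend (inj₂ e) (inj₂ pq) =
      inj₂ (deficient (bit (f x)) _ (count f l) _ (length l) (bit (f z)) _ (≤-trans (+-mono-≤ pq (n≤1+n _)) e))

≢true⇒≡false : ∀ {b} → b ≢ true → b ≡ false
≢true⇒≡false {true}  ne = contradiction refl ne
≢true⇒≡false {false} _  = refl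

true≢false : ∀ {b} → b ≡ true → b ≡ false → ⊥
true≢false refl ()

Unique-resp-↭ : ∀ {A : Set} {xs ys : List A} → xs ↭ ys → Unique xs → Unique ys
Unique-resp-↭ {A} p = Permutationₛ.Unique-resp-↭ (setoid A) (↭⇒↭ₛ p)

count≡0 : ∀ {A : Set} (f : A → Bool) xs → count f xs ≡ 0 → All (λ x → f x ≡ false) xs
count≡0 f []       _ = []
count≡0 f (x ∷ xs) e with f x in fx
... | false = fx ∷ count≡0 f xs e

Linked-drop : ∀ {A : Set} {R : A → A → Set} xs {ys} → Linked R (xs ++ ys) → Linked R ys
Linked-drop []            lk        = lk
Linked-drop (x ∷ [])      [-]       = []
Linked-drop (x ∷ [])      (_ ∷ lk)  = lk
Linked-drop (x ∷ x′ ∷ xs) (_ ∷ lk)  = Linked-drop (x′ ∷ xs) lk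

AllPairs-lookup : ∀ {A : Set} {R : A → A → Set} {xs u v} → AllPairs R xs → u ∈ₗ xs → v ∈ₗ xs → u ≡ v ⊎ R u v ⊎ R v u
AllPairs-lookup (_ ∷ _)  (here refl) (here refl) = inj₁ refl
AllPairs-lookup (p ∷ _)  (here refl) (there v∈)  = inj₂ (inj₁ (All.lookup p v∈))
AllPairs-lookup (p ∷ _)  (there u∈)  (here refl) = inj₂ (inj₂ (All.lookup p u∈))
AllPairs-lookup (_ ∷ ps) (there u∈)  (there v∈)  = AllPairs-lookup ps u∈ v∈

-- Bypassed vertices, pivots and successors on a route.

module _ {n} (G : Graph n) where

  no-loop : ∀ {u} → ¬ adj G u u ≡ true
  no-loop e = true≢false e (irrefl G _)

  adj-sym : ∀ {u v b} → adj G u v ≡ b → adj G v u ≡ b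
  adj-sym = ≡-trans (Graph.sym G _ _)

  -- `u`, `w`, `v` are consecutive. With `f` and `h` the neighbourhoods of the ends `b` and `a`, the
  -- chords recorded by `fu` and `hv` let the other vertices form a cycle that avoids `w` and gains
  -- no gap.
  record Skip (f h : Fin n → Bool) (x z : Fin n) (l : List (Fin n)) (k : ℕ) : Set where
    constructor skip
    field
      {u w v} : Fin n
      {l₁ l₂} : List (Fin n)
      {k₁ k₂} : ℕ
      left    : Route G x u l₁ k₁
      right   : Route G v z l₂ k₂
      l≡      : l ≡ l₁ ++ w ∷ l₂
      k≥      : k₁ + k₂ ≤ k
      fu      : f u ≡ true
      hv      : h v ≡ true

  -- Where a run of `f` first breaks, at `y` say, exactness gives `h` at the entry after `y`, so `y`
  -- can be bypassed. A break at the last entry has no successor, hence the run covers all entries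
  -- but the last.
  skip-or-run : ∀ f h {x z l k} → Route G x z l k → f x ≡ true → Linked (Exact f h) l →
                Skip f h x z l k ⊎ Linked (λ u _ → f u ≡ true) l
  skip-or-run f h (stop x) fx ex = inj₂ [-]
  skip-or-run f h (step x (stop y)) fx ex = inj₂ (fx ∷ [-])
  skip-or-run f h (step x (step y {k = k} r)) fx ex with f y in fy | route-∷ G r
  skip-or-run f h (step x (step y r)) fx (_ ∷ ex@(_ ∷ _)) | true | _ , refl
    with skip-or-run f h (step y r) fy ex
  ... | inj₁ (skip {k₁ = k₁} {k₂} left right l≡ le fu hv) =
    inj₁ (skip (step x left) right (cong (x ∷_) l≡) (≤-trans (≤-reflexive (+-assoc _ k₁ k₂)) (+-monoʳ-≤ (gap G x y) le)) fu hv)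
  ... | inj₂ run = inj₂ (fx ∷ run)
  skip-or-run f h (step x (step y {y = v} {k = k} r)) fx (_ ∷ e ∷ _) | false | _ , refl =
    inj₁ (skip {w = y} (stop x) r refl (≤-trans (m≤n+m k (gap G y v)) (m≤n+m _ (gap G x y))) fx (≡-trans e (cong not fy)))

  -- `c` belongs to both pieces, ending `l₁` and heading `c ∷ l₂`, which is the form `glue` expects.
  record Pivot (f h : Fin n → Bool) (x z : Fin n) (l : List (Fin n)) (k : ℕ) : Set where
    constructor pivot
    field
      {c}     : Fin n
      {l₁ l₂} : List (Fin n)
      {k₁ k₂} : ℕ
      left    : Route G x c l₁ k₁
      right   : Route G c z (c ∷ l₂) k₂
      l≡      : l ≡ l₁ ++ l₂
      k≡      : k ≡ k₁ + k₂
      fc      : f c ≡ true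
      hs      : Linked (λ _ v → h v ≡ true) l₁

  -- The pivot is the first entry satisfying `f`; as long as `f` fails, exactness puts `h` on the
  -- next entry.
  first-true : ∀ f h {x z l k} → Route G x z l k → Linked (Exact f h) l →
               Pivot f h x z l k ⊎ Linked (λ _ v → h v ≡ true) l
  first-true f h (stop x) ex with f x in fx
  ... | true  = inj₁ (pivot (stop x) (stop x) refl refl fx [-])
  ... | false = inj₂ [-]
  first-true f h (step x r) ex with f x in fx | route-∷ G r
  first-true f h (step x r) ex | true | _ , refl = inj₁ (pivot (stop x) (step x r) refl refl fx [-])
  first-true f h (step x {y = y} r) (e ∷ ex) | false | _ , refl with first-true f h r ex
  ... | inj₂ hs = inj₂ (≡-trans e (cong not fx) ∷ hs)
  ... | inj₁ (pivot {k₁ = k₁} left right l≡ refl fc hs) with route-∷ G left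
  ... | _ , refl = inj₁ (pivot (step x left) right (cong (x ∷_) l≡) (≡-sym (+-assoc (gap G x y) k₁ _)) fc
                              (≡-trans e (cong not fx) ∷ hs))

  gapless : ∀ {x z l k} → Route G x z l k → Linked (λ u v → ¬ adj G u v ≡ false) l → k ≡ 0
  gapless (stop x) _ = refl
  gapless (step x r) lk with route-∷ G r
  gapless (step x {y} r) (a ∷ lk) | _ , refl with adj G x y
  ... | true  = gapless r lk
  ... | false = contradiction refl a

  route-[-] : ∀ {x y z k} → Route G x y (z ∷ []) k → x ≡ y
  route-[-] (stop x) = refl

  last-∈-tail : ∀ {x y z m k} → Route G x y (z ∷ m) k → 2 ≤ length (z ∷ m) → y ∈ₗ m
  last-∈-tail (stop _) (s≤s ())
  last-∈-tail (step _ r) _ with route-∷ʳ G r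
  ... | m , refl = ∈-resp-↭ (++-comm (_ ∷ []) m) (here refl)

  -- The entries whose predecessor satisfies f; the Boolean stands for the predecessor of the first entry.
  starts : (Fin n → Bool) → Bool → List (Fin n) → List (Fin n)
  starts f t     []       = []
  starts f true  (x ∷ xs) = x ∷ starts f (f x) xs
  starts f false (x ∷ xs) = starts f (f x) xs

  length-starts : ∀ f t xs {y} → length (starts f t (xs ∷ʳ y)) ≡ bit t + count f xs
  length-starts f true  []       = refl
  length-starts f false []       = refl
  length-starts f true  (x ∷ xs) = cong suc (length-starts f (f x) xs)
  length-starts f false (x ∷ xs) = length-starts f (f x) xs

  starts-All : ∀ f t {P : Fin n → Set} {xs} → All P xs → All P (starts f t xs)
  starts-All f t     []       = []
  starts-All f true  (p ∷ ps) = p ∷ starts-All f _ ps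
  starts-All f false (p ∷ ps) = starts-All f _ ps

  starts-Unique : ∀ f t {xs} → Unique xs → Unique (starts f t xs)
  starts-Unique f t     []       = []
  starts-Unique f true  (p ∷ ps) = starts-All f _ p ∷ starts-Unique f _ ps
  starts-Unique f false (p ∷ ps) = starts-Unique f _ ps

  starts-prefix : ∀ f t {P : Fin n → Set} xs {ys} → All P (starts f t (xs ++ ys)) → All P (starts f t xs)
  starts-prefix f t     []       _        = []
  starts-prefix f true  (x ∷ xs) (p ∷ ps) = p ∷ starts-prefix f _ xs ps
  starts-prefix f false (x ∷ xs) ps       = starts-prefix f _ xs ps

  -- The starts fail `f`, so they are disjoint from the entries that `count f` counts.
  starts-sparse : ∀ f t xs → All (λ x → f x ≡ false) (starts f t xs) → length (starts f t xs) + count f xs ≤ length xs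
  starts-sparse f t     []       _ = z≤n
  starts-sparse f true  (x ∷ xs) (p ∷ ps) =
    s≤s (≤-trans (≤-reflexive (cong (λ b → length (starts f (f x) xs) + (bit b + count f xs)) p)) (starts-sparse f _ xs ps))
  starts-sparse f false (x ∷ xs) ps =
    ≤-by 0 (+-mono-≤ (bit≤1 (f x)) (starts-sparse f _ xs ps)) (lem (length (starts f (f x) xs)) (bit (f x)) (count f xs) _)
    where
    lem : ∀ s b c l → s + (b + c) + suc l + 0 ≡ suc l + (b + (s + c))
    lem = solve-∀

  -- The Ore-type theorem on a vertex list.

  module Arrangements (W : List (Fin n)) (unique : Unique W) (3≤|W| : 3 ≤ length W) where

    degᵂ : Fin n → ℕ
    degᵂ u = count (adj G u) W

    -- A cyclic arrangement of `W`, cut open between `y` and `x`; the gap of the closing pair is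
    -- counted as well.
    Within : ℕ → Set
    Within c = ∃ λ x → ∃ λ y → ∃ λ l → ∃ λ k → Route G x y l k × l ↭ W × k + gap G y x ≤ c

    weaken : ∀ {c d} → c ≤ d → Within c → Within d
    weaken c≤d (x , y , l , k , r , p , le) = x , y , l , k , r , p , ≤-trans le c≤d

    data Structure : Set where
      cut-vertex : ∀ x P Q → x ∷ P ++ Q ↭ W → P ≢ [] → Q ≢ [] →
                   (∀ {p q} → p ∈ₗ P → q ∈ₗ Q → adj G p q ≡ false) → Structure
      independent : ∀ I → Unique I → All (_∈ₗ W) I → (∀ {u v} → u ∈ₗ I → v ∈ₗ I → adj G u v ≡ false) →
                    2 * length I ≡ suc (length W) → Structure

    HamCycle : Set
    HamCycle = ∃ λ x → ∃ λ y → ∃ λ l → Route G x y l 0 × adj G y x ≡ true × l ↭ W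

    close : ∀ {x y l k e} → Route G x y l k → l ↭ W → k ≤ e → adj G y x ≡ true → Within e
    close {k = k} r p le a = _ , _ , _ , _ , r , p ,
      ≤-trans (≤-reflexive (≡-trans (cong (k +_) (gap≡0 G a)) (+-identityʳ k))) le

    deg-sum : ∀ {a b l} → l ↭ W → suc (degᵂ b + degᵂ a) ≡ suc (count (adj G b) l + count (adj G a) l)
    deg-sum {a} {b} p = cong suc (cong₂ _+_ (count-↭ (adj G b) (↭-sym p)) (count-↭ (adj G a) (↭-sym p)))

    loopless : ∀ {a b l} → l ↭ W → length l + (bit (adj G b b) + bit (adj G a a)) ≡ length W
    loopless {a} {b} {l} p = ≡-trans (cong₂ (λ s t → length l + (bit s + bit t)) (irrefl G b) (irrefl G a))
                                     (≡-trans (+-identityʳ _) (↭-length p))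

    long : ∀ {l} → l ↭ W → 2 ≤ length l
    long p = subst (2 ≤_) (≡-sym (↭-length p)) (≤-trans (n≤1+n 2) 3≤|W|)

    -- Ore's crossing argument.
    flip : ∀ {a b l k} → Route G a b l k → l ↭ W →
           Within k ⊎ (Linked (Exact (adj G b) (adj G a)) l × suc (degᵂ b + degᵂ a) ≡ length W
                       ⊎ suc (suc (degᵂ b + degᵂ a)) ≤ length W)
    flip {a} {b} {l} r l↭W with search G (λ u v → (adj G b u ≟ᵇ true) ×-dec (adj G a v ≟ᵇ true)) r
    ... | inj₁ (split {u} {v} {l₁} {l₂} {k₁} {k₂} left right refl refl (b~u , a~v)) =
      inj₁ (close (append G left (rev G right)) (↭-trans (++⁺ˡ l₁ (↭-reverse l₂)) l↭W)
                  (+-monoʳ-≤ k₁ (≤-trans (≤-reflexive (cong (_+ k₂) (gap≡0 G (adj-sym b~u)))) (m≤n+m k₂ (gap G u v))))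
                  (adj-sym a~v))
    ... | inj₂ lk with no-clash-count G (adj G b) (adj G a) r lk
    ... | inj₁ (ex , e) = inj₂ (inj₁ (ex , ≡-trans (deg-sum l↭W) (≡-trans e (loopless l↭W))))
    ... | inj₂ e = inj₂ (inj₂ (subst₂ _≤_ (cong suc (≡-sym (deg-sum l↭W))) (loopless l↭W) e))

    -- If p precedes and q follows the pivot and p ~ q, then a is joined to the successor p′ of p and b to
    -- the predecessor q′ of q, so a … p q … b q′ … p′ closes up with one gap less.
    exchange : ∀ {a b l k} → (pv : Pivot (adj G b) (adj G a) a b l k) → l ↭ W →
               Linked (λ u _ → adj G b u ≡ true) (Pivot.c pv ∷ Pivot.l₂ pv) → adj G a b ≡ false →
               Within k ⊎ Structure
    exchange {a} {b} (pivot {c} {L₁} {m} {j₁} {j₂} left right refl refl b~c a~) l↭W b~ a≁b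
      with search G (λ p _ → any? (λ q → adj G p q ≟ᵇ true) m) left
    -- No vertex before `c` has a neighbour after `c`, so `c` separates the two parts.
    ... | inj₂ lk = inj₂ (apart (route-∷ʳ G left))
      where
      apart : (∃ λ P → L₁ ≡ P ∷ʳ c) → Structure
      apart (P , refl) = cut-vertex c P m (↭-trans perm l↭W) P≢[] m≢[] sep
        where
        perm : c ∷ P ++ m ↭ (P ∷ʳ c) ++ m
        perm = ↭-trans (↭-sym (shift c P m)) (↭-reflexive (≡-sym (++-assoc P (c ∷ []) m)))
        P≢[] : P ≢ []
        P≢[] refl = true≢false (subst (λ t → adj G b t ≡ true) (≡-sym (route-[-] left)) b~c) (adj-sym a≁b)
        m≢[] : m ≢ []
        m≢[] refl = no-loop (subst (λ t → adj G b t ≡ true) (route-[-] right) b~c)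
        sep : ∀ {p q} → p ∈ₗ P → q ∈ₗ m → adj G p q ≡ false
        sep p∈ q∈ = ≢true⇒≡false (All.lookup (¬Any⇒All¬ m (All.lookup (Linked-init P lk) p∈)) q∈)
    ... | inj₁ sp@(split {p} {p′} {A} {M₁} {kA} {kM₁} leftA rightM refl refl p~m)
      with search G (λ _ q → adj G p q ≟ᵇ true) right
    ... | inj₂ lk = contradiction p~m (All¬⇒¬Any (Linked-tail m lk))
    ... | inj₁ sq@(split {q′} {q} {_} {B} {kM₂} {kB} leftM rightB eq eqk p~q) with route-∷ G leftM
    exchange {a} {b} (pivot {c} left right refl refl b~c a~) l↭W b~ a≁b
      | inj₁ sp@(split {p} {p′} {A} {M₁} {kA} {kM₁} leftA rightM refl refl p~m)
      | inj₁ sq@(split {q′} {q} {_} {B} {kM₂} {kB} leftM rightB refl refl p~q) | m′ , refl =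
      inj₁ (close (append G (append G leftA rightB) (rev G (glue G rightM leftM))) perm cost
                  (adj-sym (split-linked G sp a~)))
      where
      cost : kA + (gap G p q + kB) + (gap G b q′ + (kM₁ + kM₂)) ≤
             kA + (gap G p p′ + kM₁) + (kM₂ + (gap G q′ q + kB))
      cost rewrite gap≡0 G p~q | gap≡0 G (split-linked G sq b~) =
        ≤-trans (m≤m+n _ (gap G p p′ + gap G q′ q)) (≤-reflexive (lem kA kB kM₁ kM₂ (gap G p p′) (gap G q′ q)))
        where
        lem : ∀ a b c d e f → a + b + (c + d) + (e + f) ≡ a + (e + c) + (d + (f + b))
        lem = solve-∀
      perm : (A ++ B) ++ reverse (M₁ ++ m′) ↭ W
      perm = ↭-trans (begin
        (A ++ B) ++ reverse (M₁ ++ m′)  ↭⟨ ++⁺ˡ (A ++ B) (↭-reverse (M₁ ++ m′)) ⟩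
        (A ++ B) ++ (M₁ ++ m′)          ≡⟨ ++-assoc A B (M₁ ++ m′) ⟩
        A ++ (B ++ (M₁ ++ m′))          ↭⟨ ++⁺ˡ A (++-comm B (M₁ ++ m′)) ⟩
        A ++ ((M₁ ++ m′) ++ B)          ≡⟨ cong (A ++_) (++-assoc M₁ m′ B) ⟩
        A ++ (M₁ ++ (m′ ++ B))          ≡⟨ ++-assoc A M₁ (m′ ++ B) ⟨
        (A ++ M₁) ++ (m′ ++ B)          ∎) l↭W
        where open PermutationReasoning

    -- The degree bound is what `flip` leaves when a path with these ends cannot be improved. It
    -- later bounds the size of the independent set from below.
    Far : Fin n → Fin n → Set
    Far q q′ = adj G q q′ ≡ false × suc (degᵂ q + degᵂ q′) ≤ length W

    module Insert (w : Fin n) (e : ℕ) where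

      -- q and z are the successors of the neighbours b and p of w on a cycle avoiding w.
      detour : ∀ {q p z b M Z j k} → Route G q p M j → Route G z b Z k → adj G w p ≡ true → adj G w b ≡ true →
               w ∷ M ++ Z ↭ W → j + k ≤ e → Within e ⊎ Far q z
      detour {q} {p} {z} {b} {M} {Z} {j} {k} r s w~p w~b perm le = result (adj G z q ≟ᵇ true) (flip path perm′)
        where
        path  = append G (append G r (stop w)) (rev G s)
        perm′ : (M ++ w ∷ []) ++ reverse Z ↭ W
        perm′ = ↭-trans (++⁺ˡ (M ++ w ∷ []) (↭-reverse Z))
                 (↭-trans (↭-reflexive (++-assoc M (w ∷ []) Z)) (↭-trans (shift w M Z) perm))
        cost : j + (gap G p w + 0) + (gap G w b + k) ≤ e
        cost rewrite gap≡0 G (adj-sym w~p) | gap≡0 G w~b | +-identityʳ j = le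
        result : Dec (adj G z q ≡ true) → _ → Within e ⊎ Far q z
        result (yes z~q) _        = inj₁ (close path perm′ cost z~q)
        result (no _)    (inj₁ i) = inj₁ (weaken cost i)
        result (no z≁q)  (inj₂ (inj₁ (_ , d))) =
          inj₂ (adj-sym (≢true⇒≡false z≁q) , ≤-reflexive (≡-trans (cong suc (+-comm (degᵂ q) _)) d))
        result (no z≁q)  (inj₂ (inj₂ d)) =
          inj₂ (adj-sym (≢true⇒≡false z≁q) , ≤-trans (≤-reflexive (cong suc (+-comm (degᵂ q) _))) (≤-trans (n≤1+n _) d))

      -- Each call moves one vertex from `Z` to the end of `M`; when the vertex `p` before the
      -- boundary is a neighbour of `w`, `detour` settles the pair `q`, `z`.
      far-starts : ∀ {q p z b M Z j k} → Route G q p M j → Route G z b Z k → adj G w b ≡ true →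
                   w ∷ M ++ Z ↭ W → j + (gap G p z + k) ≤ e →
                   Within e ⊎ All (Far q) (starts (adj G w) (adj G w p) Z)
      far-starts {q} {p} {z} {b} {M} {Z} {j} {k} r s w~b perm le with adj G w p in wp | route-∷ G s
      ... | t | Z′ , refl = tail t wp s
        where
        here? : ∀ t → adj G w p ≡ t → ∀ {xs} → Within e ⊎ All (Far q) (starts (adj G w) (adj G w z) xs) →
                Within e ⊎ All (Far q) (starts (adj G w) t (z ∷ xs))
        here? t     _   (inj₁ i) = inj₁ i
        here? false _   (inj₂ a) = inj₂ a
        here? true  w~p (inj₂ a)
          with detour r s w~p w~b perm (≤-trans (+-monoʳ-≤ j (m≤n+m k (gap G p z))) le)
        ... | inj₁ i = inj₁ i
        ... | inj₂ f = inj₂ (f ∷ a)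
        tail : ∀ t → adj G w p ≡ t → Route G z b (z ∷ Z′) k → Within e ⊎ All (Far q) (starts (adj G w) t (z ∷ Z′))
        tail t wp (stop _) = here? t wp (inj₂ [])
        tail t wp (step _ {y = y} {k = k′} s′) = here? t wp
          (far-starts (append G r (stop z)) s′ w~b
             (↭-trans (prep w (↭-reflexive (++-assoc M (z ∷ []) Z′))) perm)
             (≤-trans (≤-reflexive (≡-trans (cong (λ t → j + t + (gap G z y + k′)) (+-identityʳ (gap G p z)))
                                            (+-assoc j (gap G p z) _))) le))

      -- If `w` is adjacent to `q`, it fits between `b` and `q` without a new gap. Otherwise `q` is
      -- compared with all other successors of neighbours.
      start : ∀ {q b Z k} → Route G q b (q ∷ Z) k → adj G w b ≡ true → w ∷ q ∷ Z ↭ W → k + gap G b q ≤ e →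
              Within e ⊎ (adj G w q ≡ false × All (Far q) (starts (adj G w) (adj G w q) Z))
      start {q} {b} {Z} {k} r w~b perm le = result (adj G w q ≟ᵇ true) r
        where
        cost : k + (gap G b w + 0) ≤ e
        cost rewrite gap≡0 G (adj-sym w~b) | +-identityʳ k = ≤-trans (m≤m+n k _) le
        result : Dec (adj G w q ≡ true) → Route G q b (q ∷ Z) k →
                 Within e ⊎ (adj G w q ≡ false × All (Far q) (starts (adj G w) (adj G w q) Z))
        result (yes w~q) _ =
          inj₁ (close (append G r (stop w)) (↭-trans (++-comm (q ∷ Z) (w ∷ [])) perm) cost w~q)
        result (no w≁q) (stop _)   = inj₂ (≢true⇒≡false w≁q , [])
        result (no w≁q) (step _ s) with far-starts (stop q) s w~b perm (≤-trans (m≤m+n k _) le)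
        ... | inj₁ i = inj₁ i
        ... | inj₂ f = inj₂ (≢true⇒≡false w≁q , f)

      Good : List (Fin n) → Set
      Good xs = All (λ x → adj G w x ≡ false) xs × AllPairs Far xs

      -- For a successor `z` of a neighbour `p`, the cycle is rotated to begin at `z` and end at
      -- `p`, so that `start` applies. Only the comparisons with later successors are kept, which is
      -- what `AllPairs` asks for.
      good-starts : ∀ {a p z b P Z j k} → Route G a p P j → Route G z b Z k → adj G w b ≡ true →
                    w ∷ P ++ Z ↭ W → j + (gap G p z + k) + gap G b a ≤ e →
                    Within e ⊎ Good (starts (adj G w) (adj G w p) Z)
      good-starts {a} {p} {z} {b} {P} {Z} {j} {k} r s w~b perm le with adj G w p in wp | route-∷ G s
      ... | t | Z′ , refl = tail t wp s
        where
        here? : ∀ t → adj G w p ≡ t → Within e ⊎ Good (starts (adj G w) (adj G w z) Z′) →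
                Within e ⊎ Good (starts (adj G w) t (z ∷ Z′))
        here? t     _   (inj₁ i) = inj₁ i
        here? false _   (inj₂ g) = inj₂ g
        here? true  w~p (inj₂ (as , ps))
          with start (append G s r) w~p (↭-trans (prep w (++-comm (z ∷ Z′) P)) perm)
                     (≤-trans (≤-reflexive (lem k (gap G b a) j (gap G p z))) le)
          where
          lem : ∀ k g j h → k + (g + j) + h ≡ j + (h + k) + g
          lem = solve-∀
        ... | inj₁ i = inj₁ i
        ... | inj₂ (w≁z , fs) = inj₂ (w≁z ∷ as , starts-prefix (adj G w) (adj G w z) Z′ fs ∷ ps)
        tail : ∀ t → adj G w p ≡ t → Route G z b (z ∷ Z′) k → Within e ⊎ Good (starts (adj G w) t (z ∷ Z′))
        tail t wp (stop _) = here? t wp (inj₂ ([] , []))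
        tail t wp (step _ {y = y} {k = k′} s′) = here? t wp
          (good-starts (append G r (stop z)) s′ w~b
             (↭-trans (prep w (↭-reflexive (++-assoc P (z ∷ []) Z′))) perm)
             (≤-trans (≤-reflexive (cong (_+ gap G b a)
                         (≡-trans (cong (λ t → j + t + (gap G z y + k′)) (+-identityʳ (gap G p z)))
                                  (+-assoc j (gap G p z) _)))) le))

      all-good : ∀ {a b Z k} → Route G a b (a ∷ Z) k → adj G w b ≡ true → w ∷ a ∷ Z ↭ W → k + gap G b a ≤ e →
                 Within e ⊎ Good (a ∷ starts (adj G w) (adj G w a) Z)
      all-good {a} {b} {Z} {k} r w~b perm le with start r w~b perm le
      ... | inj₁ i = inj₁ i
      ... | inj₂ (w≁a , fs) = rest r
        where
        rest : Route G a b (a ∷ Z) k → Within e ⊎ Good (a ∷ starts (adj G w) (adj G w a) Z)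
        rest (stop _)   = inj₂ (w≁a ∷ [] , [] ∷ [])
        rest (step _ s) with good-starts (stop a) s w~b perm le
        ... | inj₁ i         = inj₁ i
        ... | inj₂ (as , ps) = inj₂ (w≁a ∷ as , fs ∷ ps)

    module Ore (ore : ∀ {u v} → u ∈ₗ W → v ∈ₗ W → u ≢ v → adj G u v ≡ false →
                      length W ≤ suc (degᵂ u + degᵂ v)) where

      -- The successors of the neighbours of `w` around the cycle, with `a` among them as the
      -- successor of `b`, are as many as the neighbours of `w`. If no gap can be removed, they are
      -- independent together with `w`.
      insert-last : ∀ {w a b C j e} → Route G a b C j → w ∷ C ↭ W → j + gap G b a ≤ e → adj G w b ≡ true →
                    Within e ⊎ Structure
      insert-last {w} {a} {b} {C} {j} {e} r perm le w~b with route-∷ G r | route-∷ʳ G r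
      ... | Z , refl | D , C≡ with Insert.all-good w e r w~b perm le
      ... | inj₁ i = inj₁ i
      ... | inj₂ (as , ps) = inj₂ (build (starts f (f a) Z) refl)
        where
        f : Fin n → Bool
        f = adj G w
        uC : Unique (w ∷ a ∷ Z)
        uC = Unique-resp-↭ (↭-sym perm) unique
        |W| : suc (suc (length Z)) ≡ length W
        |W| = ↭-length perm
        |S| : suc (length (starts f (f a) Z)) ≡ suc (count f D)
        |S| = ≡-trans (cong (λ l → length (starts f true l)) C≡) (length-starts f true D)
        deg-w : degᵂ w ≡ suc (count f D)
        deg-w = begin
          count f W                    ≡⟨ count-↭ f perm ⟨
          bit (f w) + count f (a ∷ Z)  ≡⟨ cong₂ (λ b l → bit b + count f l) (irrefl G w) C≡ ⟩
          count f (D ∷ʳ b)             ≡⟨ count-++ f D (b ∷ []) ⟩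
          count f D + (bit (f b) + 0)  ≡⟨ cong (λ t → count f D + (bit t + 0)) w~b ⟩
          count f D + 1                ≡⟨ +-comm _ 1 ⟩
          suc (count f D)              ∎
          where open ≡-Reasoning
        build : ∀ T → starts f (f a) Z ≡ T → Structure
        -- `a` is the only successor, so `b` is the only neighbour of `w` and cuts it off.
        build [] eq = cut-vertex b (w ∷ []) D
          (↭-trans (swap b w refl) (↭-trans (prep w (↭-trans (++-comm (b ∷ []) D) (↭-reflexive (≡-sym C≡)))) perm))
          (λ ()) D≢[] sep
          where
          D≢[] : D ≢ []
          D≢[] refl = <⇒≱ 3≤|W| (≤-reflexive (≡-trans (≡-sym |W|) (cong (λ l → suc (length l)) C≡)))
          sep : ∀ {p q} → p ∈ₗ w ∷ [] → q ∈ₗ D → adj G p q ≡ false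
          sep (here refl) q∈ = All.lookup (count≡0 f D (≡-trans (≡-sym (suc-injective |S|)) (cong length eq))) q∈
        build (s ∷ T) eq = independent (w ∷ S) uI memI indep
          (≤-antisym upper (lower (subst (λ xs → Facts (a ∷ xs)) eq (ps , as , memI , uI))))
          where
          S = starts f true (a ∷ Z)
          uI : Unique (w ∷ S)
          uI with uC
          ... | w∉ ∷ uC′ = starts-All f true w∉ ∷ starts-Unique f true uC′
          memI : All (_∈ₗ W) (w ∷ S)
          memI with All.tabulate (λ {x} (x∈ : x ∈ₗ w ∷ a ∷ Z) → ∈-resp-↭ perm x∈)
          ... | w∈ ∷ C⊆W = w∈ ∷ starts-All f true C⊆W
          indep : ∀ {u v} → u ∈ₗ w ∷ S → v ∈ₗ w ∷ S → adj G u v ≡ false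
          indep (here refl) (here refl) = irrefl G w
          indep (here refl) (there v∈)  = All.lookup as v∈
          indep (there u∈)  (here refl) = adj-sym (All.lookup as u∈)
          indep (there u∈)  (there v∈) with AllPairs-lookup ps u∈ v∈
          ... | inj₁ refl              = irrefl G _
          ... | inj₂ (inj₁ (u≁v , _)) = u≁v
          ... | inj₂ (inj₂ (v≁u , _)) = adj-sym v≁u
          degʷ : degᵂ w ≡ length S
          degʷ = ≡-trans deg-w (≡-sym |S|)
          count-C : count f (a ∷ Z) ≡ length S
          count-C = ≡-trans (≡-trans (cong (λ b → bit b + count f (a ∷ Z)) (≡-sym (irrefl G w))) (count-↭ f perm)) degʷ
          -- `S` and the neighbours of `w` are disjoint sets of equal size on a cycle of `length W`
          -- minus one vertices.
          upper : 2 * suc (length S) ≤ suc (length W)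
          upper = subst (λ t → 2 * suc (length S) ≤ suc t) |W|
            (≤-by 0 (≤-trans (≤-reflexive (cong (length S +_) (≡-sym count-C))) (starts-sparse f true (a ∷ Z) as))
                    (lem (length S) (length Z)))
            where
            lem : ∀ r z → 2 * suc r + suc z + 0 ≡ suc (suc (suc z)) + (r + r)
            lem = solve-∀
          Facts : List (Fin n) → Set
          Facts xs = AllPairs Far xs × All (λ x → f x ≡ false) xs × All (_∈ₗ W) (w ∷ xs) × Unique (w ∷ xs)
          -- The Ore bounds for `w`, `a` and for `w`, `s`, where `w` has degree `length S`, are
          -- played against the `Far` bound on the degrees of `a` and `s`; two successors are needed
          -- for this.
          lower : Facts (a ∷ s ∷ T) → suc (length W) ≤ 2 * suc (length S)
          lower (((_ , far) ∷ _) ∷ _ , w≁a ∷ w≁s ∷ _ , w∈ ∷ a∈ ∷ s∈ ∷ _ , (w≢a ∷ w≢s ∷ _) ∷ _) =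
            ≤-by 0 (+-mono-≤ far (+-mono-≤ (ore w∈ a∈ w≢a w≁a) (ore w∈ s∈ w≢s w≁s)))
                 (≡-trans (cong (λ t → suc (length W) + (length W + (suc (t + degᵂ a) + suc (t + degᵂ s))) + 0) degʷ)
                          (lem (length W) (length S) (degᵂ a) (degᵂ s)))
            where
            lem : ∀ m r p q → suc m + (m + (suc (r + p) + suc (r + q))) + 0 ≡ 2 * suc r + (suc (p + q) + (m + m))
            lem = solve-∀

      -- Rotating the cycle makes some neighbour of `w` its last vertex, as `insert-last` requires.
      insert : ∀ {w a b C j e} → Route G a b C j → w ∷ C ↭ W → j + gap G b a ≤ e → Within e ⊎ Structure
      insert {w} {a} {b} {C} {j} {e} r perm le with adj G w b in wb | search G (λ u _ → adj G w u ≟ᵇ true) r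
      ... | true  | _ = insert-last r perm le wb
      ... | false | inj₁ (split {u} {v} {l₁} {l₂} {k₁} {k₂} left right refl refl w~u) =
        insert-last (append G right left) (↭-trans (prep w (++-comm l₂ l₁)) perm)
                    (≤-trans (≤-reflexive (lem k₂ (gap G b a) k₁ (gap G u v))) le) w~u
        where
        lem : ∀ k g j h → k + (g + j) + h ≡ j + (h + k) + g
        lem = solve-∀
      -- `w` has no neighbour on the cycle, so any cycle vertex, here `b`, serves as the cut vertex.
      ... | false | inj₂ lk with route-∷ʳ G r
      ... | D , refl = inj₂ (cut-vertex b (w ∷ []) D
          (↭-trans (swap b w refl) (↭-trans (prep w (++-comm (b ∷ []) D)) perm)) (λ ()) D≢[] sep)
        where
        D≢[] : D ≢ []
        D≢[] refl = <⇒≱ 3≤|W| (≤-reflexive (≡-sym (↭-length perm)))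
        sep : ∀ {p q} → p ∈ₗ w ∷ [] → q ∈ₗ D → adj G p q ≡ false
        sep (here refl) q∈ = ≢true⇒≡false (All.lookup (Linked-init D lk) q∈)

      -- Closed by the gap (b, a), the arrangement has `k + 1` gaps, so `Within k` is progress. When
      -- `flip` gives only exactness, let `c` be the first neighbour of `b` on the route: either a
      -- vertex after `c` can be bypassed, or `b` is joined to every vertex from `c` on except
      -- itself.
      improve : ∀ {a b l k} → Route G a b l k → l ↭ W → adj G b a ≡ false → Within k ⊎ Structure
      improve {a} {b} {l} {k} r perm b≁a with flip r perm
      ... | inj₁ i = inj₁ i
      ... | inj₂ (inj₂ d) = contradiction (ore (∈-resp-↭ perm b∈) (∈-resp-↭ perm a∈) b≢a b≁a) (<⇒≱ d)
        where
        a∈ : a ∈ₗ l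
        a∈ with route-∷ G r
        ... | _ , refl = here refl
        b∈ : b ∈ₗ l
        b∈ with route-∷ʳ G r
        ... | m , refl = ∈-resp-↭ (++-comm (b ∷ []) m) (here refl)
        b≢a : b ≢ a
        b≢a b≡a with route-∷ G r | Unique-resp-↭ (↭-sym perm) unique
        ... | _ , refl | a∉ ∷ _ = All.lookup a∉ (last-∈-tail r (long perm)) (≡-sym b≡a)
      ... | inj₂ (inj₁ (exact , d)) with first-true (adj G b) (adj G a) r exact
      -- Without a pivot `a` is joined to every later entry, `b` among them.
      ... | inj₂ a~ = contradiction (adj-sym b≁a) (true≢false (a~b a~))
        where
        a~b : Linked (λ _ v → adj G a v ≡ true) l → adj G a b ≡ true
        a~b a~ with route-∷ G r
        ... | m , refl = All.lookup (Linked-tail m a~) (last-∈-tail r (long perm))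
      ... | inj₁ pv@(pivot {c} {L₁} {L₂} {k₁} {k₂} left right refl refl b~c a~)
        with skip-or-run (adj G b) (adj G a) right b~c (from-pivot (route-∷ʳ G left) exact)
        where
        from-pivot : ∀ {R : Fin n → Fin n → Set} → (∃ λ P → L₁ ≡ P ∷ʳ c) → Linked R (L₁ ++ L₂) → Linked R (c ∷ L₂)
        from-pivot (P , refl) lk = Linked-drop P (subst (Linked _) (++-assoc P (c ∷ []) L₂) lk)
      ... | inj₂ b~ = exchange pv perm b~ (adj-sym b≁a)
      ... | inj₁ (skip {u} {w} {v} {l₁} {l₂} {j₁} {j₂} left′ right′ eq le b~u a~v) with route-∷ G left′ | eq
      ... | m , refl | refl =
        -- The cycle avoiding `w` runs from `a` through `c` to `u`, jumps to `b`, goes back to `v`,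
        -- and closes by the edge from `v` to `a`.
        insert (append G (glue G left left′) (rev G right′)) perm′ cost
        where
        perm′ : w ∷ (L₁ ++ m) ++ reverse l₂ ↭ W
        perm′ = ↭-trans (begin
          w ∷ (L₁ ++ m) ++ reverse l₂  ↭⟨ prep w (++⁺ˡ (L₁ ++ m) (↭-reverse l₂)) ⟩
          w ∷ (L₁ ++ m) ++ l₂          ↭⟨ shift w (L₁ ++ m) l₂ ⟨
          (L₁ ++ m) ++ w ∷ l₂          ≡⟨ ++-assoc L₁ m (w ∷ l₂) ⟩
          L₁ ++ (m ++ w ∷ l₂)          ∎) perm
          where open PermutationReasoning
        cost : k₁ + j₁ + (gap G u b + j₂) + gap G v a ≤ k₁ + k₂
        cost rewrite gap≡0 G (adj-sym b~u) | gap≡0 G (adj-sym a~v) =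
          ≤-trans (≤-reflexive (≡-trans (+-identityʳ _) (+-assoc k₁ j₁ j₂))) (+-monoʳ-≤ k₁ le)

      -- An inner gap is rotated to the closing position, where `improve` applies; without gaps the
      -- arrangement is a Hamiltonian cycle of `W`.
      refine : ∀ {c} → Within c → HamCycle ⊎ (∃ λ d → d < c × Within d) ⊎ Structure
      refine {c} (x , y , l , k , r , perm , le) with adj G y x ≟ᵇ true
      ... | no y≁x with improve r perm (≢true⇒≡false y≁x)
      ... | inj₂ s = inj₂ (inj₂ s)
      ... | inj₁ i = inj₂ (inj₁ (k , subst (λ t → k + bit (not t) ≤ c → k < c) (≡-sym (≢true⇒≡false y≁x))
                                           (≤-trans (≤-reflexive (+-comm 1 k))) le , i))
      refine {c} (x , y , l , k , r , perm , le) | yes y~x with search G (λ u v → adj G u v ≟ᵇ false) r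
      ... | inj₂ lk = inj₁ (x , y , l , subst (Route G x y l) (gapless r lk) r , y~x , perm)
      ... | inj₁ (split {u} {v} {l₁} {l₂} {k₁} {k₂} left right refl refl u≁v)
        with improve (append G right left) (↭-trans (++-comm l₂ l₁) perm) u≁v
      ... | inj₂ s = inj₂ (inj₂ s)
      ... | inj₁ i = inj₂ (inj₁ (_ , cost u≁v le , i))
        where
        lem : ∀ g j k c → suc (k + (g + j)) + c + 0 ≡ c + (j + (1 + k) + g)
        lem = solve-∀
        cost : adj G u v ≡ false → k₁ + (gap G u v + k₂) + gap G y x ≤ c → k₂ + (gap G y x + k₁) < c
        cost e le rewrite e = ≤-by 0 le (lem (gap G y x) k₁ k₂ c)

      -- Descent on the bound `c`; `m` makes the recursion structural.
      hamilton-within : ∀ m {c} → c < m → Within c → HamCycle ⊎ Structure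
      hamilton-within (suc m) (s≤s c≤m) i with refine i
      ... | inj₁ h                      = inj₁ h
      ... | inj₂ (inj₁ (d , d<c , i′)) = hamilton-within m (≤-trans d<c c≤m) i′
      ... | inj₂ (inj₂ s)              = inj₂ s

      hamilton : HamCycle ⊎ Structure
      hamilton = hamilton-within _ ≤-refl (proj₂ (initial W refl 3≤|W|))
        where
        route : ∀ x xs → ∃ λ y → ∃ λ k → Route G x y (x ∷ xs) k
        route x []        = x , 0 , stop x
        route x (x′ ∷ xs) with route x′ xs
        ... | y , k , r = y , _ , step x r
        initial : ∀ l → l ↭ W → 3 ≤ length l → ∃ Within
        initial (x ∷ xs) p _ = _ , x , _ , _ , _ , proj₂ (proj₂ (route x xs)) , p , ≤-refl

-- Vertex lists, subsets and cardinalities.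

count-all : ∀ {A : Set} (f : A → Bool) {xs} → All (λ x → f x ≡ true) xs → count f xs ≡ length xs
count-all f []       = refl
count-all f (p ∷ ps) = cong₂ _+_ (cong bit p) (count-all f ps)

count-none : ∀ {A : Set} (f : A → Bool) {xs} → All (λ x → f x ≡ false) xs → count f xs ≡ 0
count-none f []       = refl
count-none f (p ∷ ps) = cong₂ _+_ (cong bit p) (count-none f ps)

Unique-disjoint : ∀ {A : Set} (xs : List A) {ys p} → Unique (xs ++ ys) → p ∈ₗ xs → ¬ p ∈ₗ ys
Unique-disjoint (x ∷ xs) (x∉ ∷ _) (here refl) p∈ys = All.lookup x∉ (∈-++⁺ʳ xs p∈ys) refl
Unique-disjoint (x ∷ xs) (_ ∷ u)  (there p∈)  p∈ys = Unique-disjoint xs u p∈ p∈ys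

module _ {n : ℕ} where

  open DecMembership (_≟_ {n}) using () renaming (_∈?_ to _∈ₗ?_)

  ∈-tabulate⁺ : ∀ (f : Fin n → Bool) {v} → f v ≡ true → v ∈ tabulate f
  ∈-tabulate⁺ f {v} e = lookup⇒[]= v _ (≡-trans (lookup∘tabulate f v) e)

  ∈-tabulate⁻ : ∀ (f : Fin n → Bool) {v} → v ∈ tabulate f → f v ≡ true
  ∈-tabulate⁻ f {v} v∈ = ≡-trans (≡-sym (lookup∘tabulate f v)) ([]=⇒lookup v∈)

  ∣tabulate∣ : ∀ {m} (g : Fin m → Fin n) (f : Fin n → Bool) → ∣ tabulate (f ∘ g) ∣ ≡ count f (tabulateₗ g)
  ∣tabulate∣ {zero}  g f = refl
  ∣tabulate∣ {suc m} g f with f (g Fin.zero)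
  ... | true  = cong suc (∣tabulate∣ (g ∘ Fin.suc) f)
  ... | false = ∣tabulate∣ (g ∘ Fin.suc) f

  ∣tabulate∣-↭ : ∀ f {l} → l ↭ allFin n → ∣ tabulate f ∣ ≡ count f l
  ∣tabulate∣-↭ f p = ≡-trans (∣tabulate∣ id f) (count-↭ f (↭-sym p))

  ∣∣-↭ : ∀ (S : Subset n) {l} → l ↭ allFin n → ∣ S ∣ ≡ count (lookup S) l
  ∣∣-↭ S p = ≡-trans (cong ∣_∣ (≡-sym (tabulate∘lookup S))) (∣tabulate∣-↭ (lookup S) p)

  -- Presents the complement of `l` as a list, so that counts over all vertices split along `++`.
  complete : ∀ {l : List (Fin n)} → Unique l → ∃ λ l′ → l ++ l′ ↭ allFin n
  complete []       = allFin n , ↭-refl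
  complete {x ∷ l} (x∉ ∷ u) with complete u
  ... | l′ , p with ∈-++⁻ l (∈-resp-↭ (↭-sym p) (∈-allFin x))
  ... | inj₁ x∈ = contradiction refl (All.lookup x∉ x∈)
  ... | inj₂ x∈ with ∈-∃++ x∈
  ... | a , b , refl = a ++ b , ↭-trans (↭-trans (prep x (↭-reflexive (≡-sym (++-assoc l a b))))
                                          (↭-trans (↭-sym (shift x (l ++ a) b)) (↭-reflexive (++-assoc l a (x ∷ b))))) p

  ↭-allFin-length : ∀ {l} → l ↭ allFin n → length l ≡ n
  ↭-allFin-length p = ≡-trans (↭-length p) (length-tabulate id)

  ↭-allFin-unique : ∀ {l} → l ↭ allFin n → Unique l
  ↭-allFin-unique p = Unique-resp-↭ (↭-sym p) (allFin⁺ n)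

  fromList : List (Fin n) → Subset n
  fromList l = tabulate (λ v → does (v ∈ₗ? l))

  ∈-fromList⁻ : ∀ l {v} → v ∈ fromList l → v ∈ₗ l
  ∈-fromList⁻ l {v} v∈ with v ∈ₗ? l | ∈-tabulate⁻ (λ v → does (v ∈ₗ? l)) v∈
  ... | yes p | _ = p

  ∈-fromList⁺ : ∀ l {v} → v ∈ₗ l → v ∈ fromList l
  ∈-fromList⁺ l {v} v∈ = ∈-tabulate⁺ (λ v → does (v ∈ₗ? l)) (dec-true (v ∈ₗ? l) v∈)

  ∣fromList∣ : ∀ {l} → Unique l → ∣ fromList l ∣ ≡ length l
  ∣fromList∣ {l} u with complete u
  ... | l′ , p = begin
    ∣ fromList l ∣         ≡⟨ ∣tabulate∣-↭ f p ⟩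
    count f (l ++ l′)      ≡⟨ count-++ f l l′ ⟩
    count f l + count f l′ ≡⟨ cong₂ _+_ (count-all f (All.tabulate (λ {x} x∈ → dec-true (x ∈ₗ? l) x∈)))
                                        (count-none f (All.tabulate (λ {x} x∈ → dec-false (x ∈ₗ? l)
                                          (λ x∈l → Unique-disjoint l (↭-allFin-unique p) x∈l x∈)))) ⟩
    length l + 0           ≡⟨ +-identityʳ _ ⟩
    length l               ∎
    where
    open ≡-Reasoning
    f : Fin n → Bool
    f v = does (v ∈ₗ? l)

  ⊆∧∣≥∣⇒⊇ : ∀ {p q : Subset n} → p ⊆ q → ∣ q ∣ ≤ ∣ p ∣ → q ⊆ p
  ⊆∧∣≥∣⇒⊇ {p} p⊆q le {x} x∈q with x ∈? p
  ... | yes x∈p = x∈p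
  ... | no x∉p  = contradiction le (<⇒≱ (p⊂q⇒∣p∣<∣q∣ (p⊆q , x , x∈q , x∉p)))

∣∪∣≤ : ∀ {n} (p q : Subset n) → ∣ p ∪ q ∣ ≤ ∣ p ∣ + ∣ q ∣
∣∪∣≤ Vec.[]          Vec.[]          = z≤n
∣∪∣≤ (false Vec.∷ p) (false Vec.∷ q) = ∣∪∣≤ p q
∣∪∣≤ (false Vec.∷ p) (true Vec.∷ q)  = ≤-trans (s≤s (∣∪∣≤ p q)) (≤-reflexive (≡-sym (+-suc ∣ p ∣ ∣ q ∣)))
∣∪∣≤ (true Vec.∷ p)  (false Vec.∷ q) = s≤s (∣∪∣≤ p q)
∣∪∣≤ (true Vec.∷ p)  (true Vec.∷ q)  = s≤s (≤-trans (∣∪∣≤ p q) (+-monoʳ-≤ ∣ p ∣ (n≤1+n _)))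

third : ∀ {n} (p : Subset n) → 3 ≤ ∣ p ∣ → ∀ a b → ∃ λ y → y ∈ p × y ≢ a × y ≢ b
third p 3≤ a b with anyFin? (λ y → (y ∈? p) ×-dec (¬? (y ≟ a) ×-dec ¬? (y ≟ b)))
... | yes found = found
... | no none = contradiction (≤-trans 3≤ (≤-trans (p⊆q⇒∣p∣≤∣q∣ sub) (∣∪∣≤ ⁅ a ⁆ ⁅ b ⁆)))
                              (<⇒≱ (≤-reflexive (cong₂ (λ s t → suc (s + t)) (∣⁅x⁆∣≡1 a) (∣⁅x⁆∣≡1 b))))
  where
  sub : p ⊆ ⁅ a ⁆ ∪ ⁅ b ⁆
  sub {y} y∈ with y ≟ a | y ≟ b
  ... | yes refl | _        = p⊆p∪q ⁅ b ⁆ (x∈⁅x⁆ a)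
  ... | no _     | yes refl = q⊆p∪q ⁅ a ⁆ ⁅ b ⁆ (x∈⁅x⁆ b)
  ... | no y≢a   | no y≢b   = contradiction (y , y∈ , y≢a , y≢b) none

nonempty-∈ : ∀ {A : Set} {xs : List A} → xs ≢ [] → ∃ λ x → x ∈ₗ xs
nonempty-∈ {xs = []}     ne = contradiction refl ne
nonempty-∈ {xs = x ∷ xs} _  = x , here refl

-- Cycles as routes without gaps.

module _ {n} (G : Graph n) where

  deg-↭ : ∀ u {l} → l ↭ allFin n → deg G u ≡ count (adj G u) l
  deg-↭ u = ∣tabulate∣-↭ (adj G u)

  Path⇒Linked : ∀ x xs → Path G x xs → Linked (λ u v → adj G u v ≡ true) (x ∷ xs)
  Path⇒Linked x []       _       = [-]
  Path⇒Linked x (y ∷ ys) (a , p) = a ∷ Path⇒Linked y ys p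

  Path⇒Route : ∀ x xs → Path G x xs → Route G x (lastOf x xs) (x ∷ xs) 0
  Path⇒Route x []       _       = stop x
  Path⇒Route x (y ∷ ys) (a , p) = cast G refl (≡-trans (+-identityʳ _) (gap≡0 G a)) (step x (Path⇒Route y ys p))

  Route⇒Linked : ∀ {x y l k} → Route G x y l k → k ≡ 0 → Linked (λ u v → adj G u v ≡ true) l
  Route⇒Linked (stop x) _ = [-]
  Route⇒Linked (step x {y = y} r) k≡0 with route-∷ G r | adj G x y in xy
  ... | _ , refl | true = xy ∷ Route⇒Linked r k≡0
  Route⇒Linked (step x {y = y} r) () | _ , refl | false

  Linked⇒Path : ∀ {x xs} → Linked (λ u v → adj G u v ≡ true) (x ∷ xs) → Path G x xs
  Linked⇒Path [-]      = tt
  Linked⇒Path (a ∷ lk) = a , Linked⇒Path lk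

  route-last : ∀ {x y z xs k} → Route G x y (z ∷ xs) k → lastOf z xs ≡ y
  route-last (stop x) = refl
  route-last (step x r) with route-∷ G r
  ... | _ , refl = route-last r

  rotate-to : ∀ {a b l} x → Route G a b l 0 → adj G b a ≡ true → x ∈ₗ l → ∃ λ y → ∃ λ m → Route G x y m 0 × m ↭ l
  rotate-to {a} {b} x r b~a x∈ with search G (λ _ v → v ≟ x) r
  ... | inj₁ (split {l₁ = l₁} {l₂} {k₁} {k₂} left right refl k≡ refl) =
    _ , _ , cast G refl cost (append G right left) , ++-comm l₂ l₁
    where
    cost : k₂ + (gap G b a + k₁) ≡ 0
    cost rewrite gap≡0 G b~a = cong₂ _+_ (m+n≡0⇒n≡0 _ (m+n≡0⇒n≡0 k₁ (≡-sym k≡))) (m+n≡0⇒m≡0 k₁ (≡-sym k≡))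
  ... | inj₂ lk with route-∷ G r
  ... | m , refl with x∈
  ... | here refl = _ , _ , r , ↭-refl
  ... | there x∈m = contradiction refl (All.lookup (Linked-tail m lk) x∈m)

  module _ (W : List (Fin n)) (unique : Unique W) (3≤|W| : 3 ≤ length W) where

    open Arrangements G W unique 3≤|W|

    -- A Hamiltonian cycle of `W` is an `X`-cycle, hence covers the whole graph. For a `W` that
    -- misses a vertex this is a contradiction, so `X` is not contained in `W`.
    ham-forces : ∀ {X} → HForce G X → HamCycle → (∀ {x} → x ∈ X → x ∈ₗ W) → ∀ v → v ∈ₗ W
    ham-forces {X} (_ , force) (x , y , l , r , y~x , perm) X⊆W v with route-∷ G r
    ... | xs , refl = ∈-resp-↭ perm (proj₂ (force (x ∷ xs) (cyc , λ u u∈ → ∈-resp-↭ (↭-sym perm) (X⊆W u∈))) v)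
      where
      cyc : IsCycle G (x ∷ xs)
      cyc = subst (3 ≤_) (≡-sym (↭-length perm)) 3≤|W| , Unique-resp-↭ (↭-sym perm) unique ,
            Linked⇒Path (Route⇒Linked r refl) , subst (λ t → adj G t x ≡ true) (≡-sym (route-last r)) y~x

  -- P and Q are the two sides of G − v − x.
  record CutPair (v x : Fin n) (P Q : List (Fin n)) : Set where
    field
      perm : v ∷ x ∷ P ++ Q ↭ allFin n
      P≢[] : P ≢ []
      Q≢[] : Q ≢ []
      sep  : ∀ {p q} → p ∈ₗ P → q ∈ₗ Q → adj G p q ≡ false

  count-loopless : ∀ {p} P → p ∈ₗ P → suc (count (adj G p) P) ≤ length P
  count-loopless {p} (_ ∷ P) (here refl) rewrite irrefl G p = s≤s (count≤length (adj G p) P)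
  count-loopless {p} (x ∷ P) (there p∈) =
    ≤-trans (≤-reflexive (≡-sym (+-suc _ _))) (+-mono-≤ (bit≤1 (adj G p x)) (count-loopless P p∈))

  side-count : ∀ {p l} Z P Q → l ↭ Z ++ P ++ Q → p ∈ₗ P → (∀ {q} → q ∈ₗ Q → adj G p q ≡ false) →
               suc (count (adj G p) l) ≤ count (adj G p) Z + length P
  side-count {p} {l} Z P Q perm p∈ sep = begin
    suc (count f l)                          ≡⟨ cong suc (count-↭ f perm) ⟩
    suc (count f (Z ++ P ++ Q))              ≡⟨ cong suc (count-++ f Z (P ++ Q)) ⟩
    suc (count f Z + count f (P ++ Q))       ≡⟨ cong (λ t → suc (count f Z + t)) (count-++ f P Q) ⟩
    suc (count f Z + (count f P + count f Q)) ≡⟨ cong (λ t → suc (count f Z + (count f P + t)))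
                                                   (count-none f (All.tabulate sep)) ⟩
    suc (count f Z + (count f P + 0))        ≡⟨ cong (λ t → suc (count f Z + t)) (+-identityʳ _) ⟩
    suc (count f Z + count f P)              ≡⟨ +-suc (count f Z) _ ⟨
    count f Z + suc (count f P)              ≤⟨ +-monoʳ-≤ (count f Z) (count-loopless P p∈) ⟩
    count f Z + length P                     ∎
    where
    open ≤-Reasoning
    f : Fin n → Bool
    f = adj G p

-- Cut pairs: degrees on the sides and at the apices.

module _ {n} {G : Graph n} where

  swap-sides : ∀ {v x P Q} → CutPair G v x P Q → CutPair G v x Q P
  swap-sides {v} {x} {P} {Q} cut = record
    { perm = ↭-trans (prep v (prep x (++-comm Q P))) perm ; P≢[] = Q≢[] ; Q≢[] = P≢[]
    ; sep = λ q∈ p∈ → adj-sym G (sep p∈ q∈) }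
    where open CutPair cut

  swap-pair : ∀ {v x P Q} → CutPair G v x P Q → CutPair G x v P Q
  swap-pair {v} {x} cut = record { CutPair cut hiding (perm) ; perm = ↭-trans (swap x v ↭-refl) (CutPair.perm cut) }

  cut-size : ∀ {v x P Q} → CutPair G v x P Q → 2 + (length P + length Q) ≡ n
  cut-size {P = P} cut = ≡-trans (cong (2 +_) (≡-sym (length-++ P))) (↭-allFin-length (CutPair.perm cut))

  cut-degree : ∀ {v x P Q p} → CutPair G v x P Q → p ∈ₗ P →
               suc (deg G p) ≤ bit (adj G p v) + (bit (adj G p x) + 0) + length P
  cut-degree {v} {x} {P} {Q} {p} cut p∈ =
    subst (λ d → suc d ≤ bit (adj G p v) + (bit (adj G p x) + 0) + length P) (≡-sym (deg-↭ G p ↭-refl))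
      (side-count G (v ∷ x ∷ []) P Q (↭-sym (CutPair.perm cut)) p∈ (CutPair.sep cut p∈))

  cut-degree≤ : ∀ {v x P Q p} → CutPair G v x P Q → p ∈ₗ P → suc (deg G p) ≤ 2 + length P
  cut-degree≤ {v} {x} {P} {p = p} cut p∈ =
    ≤-trans (cut-degree cut p∈) (+-monoˡ-≤ (length P) (+-mono-≤ (bit≤1 (adj G p v)) (+-monoˡ-≤ 0 (bit≤1 (adj G p x)))))

  -- The degrees are at most `length P + 1` and `length Q + 1`. The weak closure joins only pairs of
  -- degree sum at least `suc n`, so it never joins the two sides.
  cut-sum : ∀ {v x P Q p q} → CutPair G v x P Q → p ∈ₗ P → q ∈ₗ Q → deg G p + deg G q ≤ n
  cut-sum {P = P} {Q} {p} {q} cut p∈ q∈ = subst (deg G p + deg G q ≤_) (cut-size cut)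
    (≤-by 0 (+-mono-≤ (cut-degree≤ cut p∈) (cut-degree≤ (swap-sides cut) q∈))
            (lem (deg G p) (deg G q) (length P) (length Q)))
    where
    lem : ∀ a b c d → a + b + (2 + c + (2 + d)) + 0 ≡ 2 + (c + d) + (suc a + suc b)
    lem = solve-∀

  cut-distinct : ∀ {v x P Q p q} → CutPair G v x P Q → p ∈ₗ P → q ∈ₗ Q → p ≢ q
  cut-distinct {P = P} cut p∈ q∈ refl with ↭-allFin-unique (CutPair.perm cut)
  ... | _ ∷ _ ∷ u = Unique-disjoint P u p∈ q∈

  -- Without the edge to `v` the degree of `p` drops by one more, and its sum with the degree of any
  -- vertex of `Q` falls below `n`.
  cut-joined : OTG G → ∀ {v x P Q p} → CutPair G v x P Q → p ∈ₗ P → adj G p v ≡ true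
  cut-joined otg {v} {x} {P} {Q} {p} cut p∈ with adj G p v in pv | nonempty-∈ (CutPair.Q≢[] cut) | cut-degree cut p∈
  ... | true  | _ | _ = refl
  ... | false | q , q∈ | dp = contradiction (otg p q (cut-distinct cut p∈ q∈) (CutPair.sep cut p∈ q∈)) (<⇒≱ small)
    where
    lem : ∀ a b c d → suc (a + b) + (1 + c + (2 + d)) + 0 ≡ 2 + (c + d) + (suc a + suc b)
    lem = solve-∀
    small : deg G p + deg G q < n
    small = subst (deg G p + deg G q <_) (cut-size cut)
      (≤-by 0 (+-mono-≤ (≤-trans dp (+-monoˡ-≤ (length P) (+-monoˡ-≤ 0 (bit≤1 (adj G p x))))) (cut-degree≤ (swap-sides cut) q∈))
            (lem (deg G p) (deg G q) (length P) (length Q)))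

  cut-joined-all : OTG G → ∀ {v x P Q u} → CutPair G v x P Q → u ∈ₗ P ++ Q → adj G v u ≡ true
  cut-joined-all otg {P = P} cut u∈ with ∈-++⁻ P u∈
  ... | inj₁ u∈P = adj-sym G (cut-joined otg cut u∈P)
  ... | inj₂ u∈Q = adj-sym G (cut-joined otg (swap-sides cut) u∈Q)

  cut-apex-degree : OTG G → ∀ {v x P Q} → CutPair G v x P Q → deg G v ≡ bit (adj G v x) + (length P + length Q)
  cut-apex-degree otg {v} {x} {P} {Q} cut = begin
    deg G v                                                 ≡⟨ deg-↭ G v (CutPair.perm cut) ⟩
    bit (adj G v v) + (bit (adj G v x) + count f (P ++ Q))
      ≡⟨ cong (λ b → bit b + (bit (adj G v x) + count f (P ++ Q))) (irrefl G v) ⟩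
    bit (adj G v x) + count f (P ++ Q)
      ≡⟨ cong (bit (adj G v x) +_) (count-all f (All.tabulate (cut-joined-all otg cut))) ⟩
    bit (adj G v x) + length (P ++ Q)                       ≡⟨ cong (bit (adj G v x) +_) (length-++ P) ⟩
    bit (adj G v x) + (length P + length Q)                 ∎
    where
    open ≡-Reasoning
    f : Fin n → Bool
    f = adj G v

  -- Each apex is joined to both sides. Nonadjacent apices would both have degree `n - 2`, and weak
  -- closedness would give `2n - 4 ≤ n`.
  cut-apices-joined : 5 ≤ n → OTG G → WClosed G → ∀ {v x P Q} → CutPair G v x P Q → adj G v x ≡ true
  cut-apices-joined 5≤n otg closed {v} {x} {P} {Q} cut with adj G v x in vx
  ... | true  = refl
  ... | false = contradiction 5≤n (<⇒≱ (s≤s (subst (_≤ 4) (cut-size cut) (≤-by 0 apex-sum eq))))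
    where
    lem : ∀ m → 2 + m + (2 + m) + 0 ≡ 4 + (m + m)
    lem = solve-∀
    eq : 2 + (length P + length Q) + n + 0 ≡ 4 + (length P + length Q + (length P + length Q))
    eq = ≡-trans (cong (λ t → 2 + (length P + length Q) + t + 0) (≡-sym (cut-size cut))) (lem (length P + length Q))
    v≢x : v ≢ x
    v≢x with ↭-allFin-unique (CutPair.perm cut)
    ... | (v≢x ∷ _) ∷ _ = v≢x
    dv : deg G v ≡ length P + length Q
    dv = ≡-trans (cut-apex-degree otg cut) (cong (λ b → bit b + _) vx)
    dx : deg G x ≡ length P + length Q
    dx = ≡-trans (cut-apex-degree otg (swap-pair cut)) (cong (λ b → bit b + _) (adj-sym G vx))
    apex-sum : length P + length Q + (length P + length Q) ≤ n
    apex-sum = s≤s⁻¹ (subst₂ (λ s t → s + t < suc n) dv dx (closed v x v≢x vx))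

  cut-apex-dominates : 5 ≤ n → OTG G → WClosed G → ∀ {v x P Q u} → CutPair G v x P Q → u ≢ v → adj G v u ≡ true
  cut-apex-dominates 5≤n otg closed {u = u} cut u≢v with ∈-resp-↭ (↭-sym (CutPair.perm cut)) (∈-allFin u)
  ... | here refl         = contradiction refl u≢v
  ... | there (here refl) = cut-apices-joined 5≤n otg closed cut
  ... | there (there u∈)  = cut-joined-all otg cut u∈

  cut-apex-degree-full : 5 ≤ n → OTG G → WClosed G → ∀ {v x P Q} → CutPair G v x P Q → deg G v ≡ n ∸ 1
  cut-apex-degree-full 5≤n otg closed cut =
    ≡-trans (cut-apex-degree otg cut)
      (≡-trans (cong (λ b → bit b + _) (cut-apices-joined 5≤n otg closed cut)) (cong (_∸ 1) (cut-size cut)))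

  -- A vertex other than the apices lies on one side, so it cannot be a common neighbour of `p` and
  -- `q`.
  between : ∀ {v x P Q p q} {Y : Subset n} → CutPair G v x P Q → p ∈ₗ P → q ∈ₗ Q →
            (∃ λ t → t ∈ Y × t ≢ v × t ≢ x) → ¬ (∀ {t} → t ∈ Y → adj G p t ≡ true × adj G q t ≡ true)
  between {P = P} cut p∈ q∈ (t , t∈ , t≢v , t≢x) joined with ∈-resp-↭ (↭-sym (CutPair.perm cut)) (∈-allFin t)
  ... | here t≡v         = t≢v t≡v
  ... | there (here t≡x) = t≢x t≡x
  ... | there (there t∈PQ) with ∈-++⁻ P t∈PQ
  ... | inj₁ t∈P = true≢false (proj₂ (joined t∈)) (adj-sym G (CutPair.sep cut t∈P q∈))
  ... | inj₂ t∈Q = true≢false (proj₁ (joined t∈)) (CutPair.sep cut p∈ t∈Q)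

-- What survives the steps of the weak closure.

module _ {n} {G G′ : Graph n} where

  step-⊆ : WStep G G′ → ∀ {a b} → adj G a b ≡ true → adj G′ a b ≡ true
  step-⊆ (_ , _ , _ , _ , _ , add) e = proj₂ (add _ _) (inj₁ e)

  step-edge : WStep G G′ → ∀ {a b} → adj G a b ≡ false → deg G a + deg G b ≤ n → adj G′ a b ≡ false
  step-edge (u , v , _ , _ , big , add) {a} {b} a≁b le = ≢true⇒≡false λ e → absurd (proj₁ (add a b) e)
    where
    absurd : EdgeOrNew G u v a b → ⊥
    absurd (inj₁ e)                    = true≢false e a≁b
    absurd (inj₂ (inj₁ (refl , refl))) = <⇒≱ big le
    absurd (inj₂ (inj₂ (refl , refl))) = <⇒≱ big (≤-trans (≤-reflexive (+-comm (deg G u) _)) le)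

  step-OTG : WStep G G′ → OTG G → OTG G′
  step-OTG st otg u v u≢v u≁v =
    ≤-trans (otg u v u≢v (≢true⇒≡false λ e → true≢false (step-⊆ st e) u≁v)) (+-mono-≤ (mono u) (mono v))
    where
    mono : ∀ u → deg G u ≤ deg G′ u
    mono u = p⊆q⇒∣p∣≤∣q∣ λ {w} w∈ → ∈-tabulate⁺ (adj G′ u) (step-⊆ st (∈-tabulate⁻ (adj G u) w∈))

  step-cut : WStep G G′ → ∀ {v x P Q} → CutPair G v x P Q → CutPair G′ v x P Q
  step-cut st cut = record
    { CutPair cut hiding (sep) ; sep = λ p∈ q∈ → step-edge st (CutPair.sep cut p∈ q∈) (cut-sum cut p∈ q∈) }

module _ {n : ℕ} where

  closure-preserves : ∀ {G H : Graph n} (Inv : Graph n → Set) → (∀ {K K′} → WStep K K′ → OTG K → Inv K → Inv K′) →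
                      Star WStep G H → OTG G → Inv G → OTG H × Inv H
  closure-preserves Inv pres ε        otg i = otg , i
  closure-preserves {G} Inv pres (_◅_ {j = K} s ss) otg i =
    closure-preserves Inv pres ss (step-OTG {G = G} {K} s otg) (pres {G} {K} s otg i)

-- Independent sets of half the vertices.

record Half {n} (G : Graph n) (S : Subset n) : Set where
  constructor half
  field
    indep : Independent G S
    size  : 2 * ∣ S ∣ ≡ n

module _ {n} (S : Subset n) (size : 2 * ∣ S ∣ ≡ n) where

  ∣∁∣ : ∣ ∁ S ∣ ≡ ∣ S ∣
  ∣∁∣ = ≡-trans (∣∁p∣≡n∸∣p∣ S) (≡-trans (cong (_∸ ∣ S ∣) (≡-sym size)) (≡-trans (m+n∸m≡n ∣ S ∣ _) (+-identityʳ _)))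

  half≥3 : 5 ≤ n → 3 ≤ ∣ S ∣
  half≥3 5≤n with 3 ≤? ∣ S ∣
  ... | yes p = p
  ... | no ¬p = contradiction (*-monoʳ-≤ 2 (s≤s⁻¹ (≰⇒> ¬p))) (<⇒≱ (subst (5 ≤_) (≡-sym size) 5≤n))

module _ {n} {G : Graph n} {S : Subset n} (5≤n : 5 ≤ n) (hf : Half G S) where

  open Half hf

  half-nbrs : ∀ {s} → s ∈ S → tabulate (adj G s) ⊆ ∁ S
  half-nbrs {s} s∈ {t} t∈ = x∉p⇒x∈∁p λ t∈S → true≢false (∈-tabulate⁻ (adj G s) t∈) (indep s t s∈ t∈S)

  half-degree : ∀ {s} → s ∈ S → deg G s ≤ ∣ S ∣
  half-degree s∈ = ≤-trans (p⊆q⇒∣p∣≤∣q∣ (half-nbrs s∈)) (≤-reflexive (∣∁∣ S size))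

  -- Degrees in `S` are at most `∣ S ∣`, and the Ore condition for `s` and another vertex of `S`
  -- forces equality. So the neighbourhood of `s` is the whole complement of `S`.
  half-joined : OTG G → ∀ {s t} → s ∈ S → t ∉ S → adj G s t ≡ true
  half-joined otg {s} {t} s∈ t∉ with third S (half≥3 S size 5≤n) s s
  ... | s′ , s′∈ , s′≢s , _ = ∈-tabulate⁻ (adj G s) (⊆∧∣≥∣⇒⊇ (half-nbrs s∈) big (x∉p⇒x∈∁p t∉))
    where
    lem : ∀ a b m → m + (a + b) + 0 ≡ a + (b + m)
    lem = solve-∀
    big : ∣ ∁ S ∣ ≤ deg G s
    big = subst (_≤ deg G s) (≡-sym (∣∁∣ S size))
      (+-cancelʳ-≤ ∣ S ∣ _ _ (begin
        ∣ S ∣ + ∣ S ∣        ≡⟨ cong (∣ S ∣ +_) (+-identityʳ _) ⟨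
        2 * ∣ S ∣            ≡⟨ size ⟩
        n                    ≤⟨ otg s s′ (s′≢s ∘ ≡-sym) (indep s s′ s∈ s′∈) ⟩
        deg G s + deg G s′   ≤⟨ +-monoʳ-≤ (deg G s) (half-degree s′∈) ⟩
        deg G s + ∣ S ∣      ∎))
      where open ≤-Reasoning

  -- An independent set that meets `S` lies inside `S`, since vertices of `S` see everything
  -- outside; one that misses `S` lies in the complement, which has the same size.
  half-largest : OTG G → LargestIndependent G S
  half-largest otg = indep , λ T indepT → bound T indepT (anyFin? (λ v → (v ∈? T) ×-dec (v ∈? S)))
    where
    bound : ∀ T → Independent G T → Dec (∃ λ v → v ∈ T × v ∈ S) → ∣ T ∣ ≤ ∣ S ∣
    bound T indepT (yes (v , v∈T , v∈S)) = p⊆q⇒∣p∣≤∣q∣ sub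
      where
      sub : T ⊆ S
      sub {t} t∈ with t ∈? S
      ... | yes t∈S = t∈S
      ... | no t∉S  = contradiction (indepT v t v∈T t∈) (true≢false (half-joined otg v∈S t∉S))
    bound T indepT (no none) =
      ≤-trans (p⊆q⇒∣p∣≤∣q∣ (λ {t} t∈ → x∉p⇒x∈∁p λ t∈S → none (t , t∈ , t∈S))) (≤-reflexive (∣∁∣ S size))

  -- `S` and its complement are completely joined and have at least three vertices each, so deleting
  -- two vertices cannot disconnect the graph.
  half-not-cut : OTG G → ∀ {v x P Q} → ¬ CutPair G v x P Q
  half-not-cut otg {v} {x} {P} {Q} cut with nonempty-∈ (CutPair.P≢[] cut) | nonempty-∈ (CutPair.Q≢[] cut)
  ... | p , p∈ | q , q∈ with p ∈? S | q ∈? S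
  ... | yes p∈S | no q∉S  = true≢false (half-joined otg p∈S q∉S) (CutPair.sep cut p∈ q∈)
  ... | no p∉S  | yes q∈S = true≢false (half-joined otg q∈S p∉S) (adj-sym G (CutPair.sep cut p∈ q∈))
  ... | yes p∈S | yes q∈S = between cut p∈ q∈
    (third (∁ S) (subst (3 ≤_) (≡-sym (∣∁∣ S size)) (half≥3 S size 5≤n)) v x)
    λ t∈ → half-joined otg p∈S (x∈∁p⇒x∉p t∈) , half-joined otg q∈S (x∈∁p⇒x∉p t∈)
  ... | no p∉S  | no q∉S  = between cut p∈ q∈ (third S (half≥3 S size 5≤n) v x)
    λ t∈ → adj-sym G (half-joined otg t∈ p∉S) , adj-sym G (half-joined otg t∈ q∉S)

half-step : ∀ {n} {K K′ : Graph n} {S} → 5 ≤ n → WStep K K′ → Half K S → Half K′ S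
half-step {K = K} {K′} {S} 5≤n st hf@(half indep size) = half
  (λ u v u∈ v∈ → step-edge {G = K} {K′} st (indep u v u∈ v∈)
     (≤-trans (+-mono-≤ (half-degree {G = K} 5≤n hf u∈) (half-degree {G = K} 5≤n hf v∈))
              (≤-reflexive (≡-trans (cong (∣ S ∣ +_) (≡-sym (+-identityʳ _))) size))))
  size

-- H-force sets from both structures, and the classification of vertices.

module _ {n} {G : Graph n} where

  -- No two consecutive vertices of a cycle lie in `S`, so a cycle containing `S` has at least
  -- `2 * ∣ S ∣` vertices, which is all of them.
  half-HForce : ∀ {S} → 5 ≤ n → Half G S → HForce G S
  half-HForce {S} 5≤n (half indep size)
    -- Vertex zero is a dummy for the excluded vertices: only some member of `S` is wanted.
    with third S (half≥3 S size 5≤n) (fromℕ< (≤-trans (s≤s z≤n) 5≤n)) (fromℕ< (≤-trans (s≤s z≤n) 5≤n))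
  ... | s , s∈ , _ = (s , s∈) , force
    where
    f : Fin n → Bool
    f = lookup S
    independent-pair : ∀ {u v} → adj G u v ≡ true → ¬ Clash f f u v
    independent-pair u~v (fu , fv) = true≢false u~v (indep _ _ (lookup⇒[]= _ S fu) (lookup⇒[]= _ S fv))
    force : ∀ c → IsXCycle G S c → IsHamCycle G c
    force (x ∷ xs) (cyc@(_ , u , path , closing) , S⊆c) with complete u
    ... | l′ , p = cyc , covers l′ p (short l′ p)
      where
      c = x ∷ xs
      z = lastOf x xs
      count-c : count f c + count f c ≤ length c
      count-c with no-clash-count G f f (Path⇒Route G x xs path) (Linked.map independent-pair (Path⇒Linked G x xs path))
      ... | e = s≤s⁻¹ (≤-trans (total e) (≤-trans (+-monoʳ-≤ (length c) (ends (f z) (f x) (independent-pair closing)))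
                                                  (≤-reflexive (+-comm _ 1))))
        where
        ends : ∀ a b → ¬ (a ≡ true × b ≡ true) → bit a + bit b ≤ 1
        ends true  true  ne = contradiction (refl , refl) ne
        ends true  false _  = ≤-refl
        ends false b     _  = bit≤1 b
        total : ∀ {A : Set} {a b} → (A × suc a ≡ b) ⊎ suc (suc a) ≤ b → suc a ≤ b
        total (inj₁ (_ , e)) = ≤-reflexive e
        total (inj₂ e)       = ≤-trans (n≤1+n _) e
      short : ∀ l′ → c ++ l′ ↭ allFin n → length l′ ≡ 0
      short l′ p = n≤0⇒n≡0 (+-cancelˡ-≤ (length c) _ _ (begin
        length c + length l′    ≡⟨ length-++ c ⟨
        length (c ++ l′)        ≡⟨ ↭-allFin-length p ⟩
        n                       ≡⟨ size ⟨
        2 * ∣ S ∣               ≡⟨ cong (∣ S ∣ +_) (+-identityʳ _) ⟩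
        ∣ S ∣ + ∣ S ∣           ≡⟨ cong₂ _+_ ∣S∣ ∣S∣ ⟩
        count f c + count f c   ≤⟨ count-c ⟩
        length c                ≡⟨ +-identityʳ _ ⟨
        length c + 0            ∎))
        where
        open ≤-Reasoning
        outside : ∀ {u} → u ∈ₗ l′ → f u ≡ false
        outside u∈ = ≢true⇒≡false λ fu → Unique-disjoint c (↭-allFin-unique p) (S⊆c _ (lookup⇒[]= _ S fu)) u∈
        ∣S∣ : ∣ S ∣ ≡ count f c
        ∣S∣ = ≡-trans (∣∣-↭ S p) (≡-trans (count-++ f c l′)
                (≡-trans (cong (count f c +_) (count-none f (All.tabulate outside))) (+-identityʳ _)))
      covers : ∀ l′ → c ++ l′ ↭ allFin n → length l′ ≡ 0 → ∀ v → v ∈ₗ c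
      covers [] p _ v = subst (v ∈ₗ_) (++-identityʳ c) (∈-resp-↭ (↭-sym p) (∈-allFin v))

  -- A path that avoids both apices cannot change sides.
  one-side : ∀ {v x P Q y m} → CutPair G v x P Q → Linked (λ a b → adj G a b ≡ true) (y ∷ m) → y ∈ₗ P →
             (∀ {u} → u ∈ₗ m → u ∈ₗ P ⊎ u ∈ₗ Q) → ∀ {u} → u ∈ₗ y ∷ m → u ∈ₗ P
  one-side cut lk y∈ sides (here refl) = y∈
  one-side cut (a ∷ lk) y∈ sides (there u∈) with sides (here refl)
  ... | inj₁ z∈P = one-side cut lk z∈P (sides ∘ there) u∈
  ... | inj₂ z∈Q = contradiction (CutPair.sep cut y∈ z∈Q) (true≢false a)

  two-sided : ∀ {v x P Q m} → CutPair G v x P Q → Linked (λ a b → adj G a b ≡ true) m →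
              (∀ {u} → u ∈ₗ m → u ∈ₗ P ++ Q) → ¬ (∀ {u} → u ∈ₗ P ++ Q → u ∈ₗ m)
  two-sided {P = P} {m = m} cut lk m⊆ ⊆m with nonempty-∈ (CutPair.P≢[] cut) | nonempty-∈ (CutPair.Q≢[] cut) | m
  ... | p , p∈ | q , q∈ | [] with () ← ⊆m (∈-++⁺ˡ p∈)
  ... | p , p∈ | q , q∈ | y ∷ m′ with ∈-++⁻ P (m⊆ (here refl))
  ... | inj₁ y∈P = cut-distinct cut (one-side cut lk y∈P (∈-++⁻ P ∘ m⊆ ∘ there) (⊆m (∈-++⁺ʳ P q∈))) q∈ refl
  ... | inj₂ y∈Q = cut-distinct cut p∈
    (one-side (swap-sides cut) lk y∈Q (Sum.swap ∘ ∈-++⁻ P ∘ m⊆ ∘ there) (⊆m (∈-++⁺ˡ p∈))) refl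

  -- If the cycle missed `v`, then removing `x` from it, when present, would leave a path with
  -- vertex set exactly `P ++ Q`, which has to cross between the sides.
  cut-visited : ∀ {v x P Q c} → CutPair G v x P Q → IsCycle G c → (∀ {u} → u ∈ₗ P ++ Q → u ∈ₗ c) → v ∈ₗ c
  cut-visited {v} {x} {P} {Q} {c@(y ∷ ys)} cut (_ , unique , path , closing) ⊆c
    with DecMembership._∈?_ _≟_ v c | DecMembership._∈?_ _≟_ x c
  ... | yes v∈ | _ = v∈
  ... | no v∉ | no x∉ = ⊥-elim (two-sided cut (Path⇒Linked G y ys path) c⊆ ⊆c)
    where
    c⊆ : ∀ {u} → u ∈ₗ c → u ∈ₗ P ++ Q
    c⊆ {u} u∈ with ∈-resp-↭ (↭-sym (CutPair.perm cut)) (∈-allFin u)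
    ... | here refl         = contradiction u∈ v∉
    ... | there (here refl) = contradiction u∈ x∉
    ... | there (there u∈′) = u∈′
  ... | no v∉ | yes x∈ with rotate-to G x (Path⇒Route G y ys path) closing x∈
  ... | z , m , r , p with route-∷ G r | Unique-resp-↭ (↭-sym p) unique
  ... | m′ , refl | x∉ ∷ _ = ⊥-elim (two-sided cut (Linked.tail (Route⇒Linked G r refl)) m⊆ ⊆m)
    where
    m⊆ : ∀ {u} → u ∈ₗ m′ → u ∈ₗ P ++ Q
    m⊆ {u} u∈ with ∈-resp-↭ (↭-sym (CutPair.perm cut)) (∈-allFin u)
    ... | here refl         = contradiction (∈-resp-↭ p (there u∈)) v∉
    ... | there (here refl) = contradiction refl (All.lookup x∉ u∈)
    ... | there (there u∈′) = u∈′
    ⊆m : ∀ {u} → u ∈ₗ P ++ Q → u ∈ₗ m′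
    ⊆m u∈ with ∈-resp-↭ (↭-sym p) (⊆c u∈) | ↭-allFin-unique (CutPair.perm cut)
    ... | there u∈m | _ = u∈m
    ... | here refl | _ ∷ x∉PQ ∷ _ = contradiction refl (All.lookup x∉PQ u∈)

  cut-HForce : ∀ {v x P Q} → CutPair G v x P Q → HForce G (fromList (P ++ Q))
  cut-HForce {v} {x} {P} {Q} cut with nonempty-∈ (CutPair.P≢[] cut)
  ... | p , p∈ = (p , ∈-fromList⁺ (P ++ Q) (∈-++⁺ˡ p∈)) , force
    where
    force : ∀ c → IsXCycle G (fromList (P ++ Q)) c → IsHamCycle G c
    force c (cyc , ⊆c) = cyc , covers
      where
      ⊆c′ : ∀ {u} → u ∈ₗ P ++ Q → u ∈ₗ c
      ⊆c′ u∈ = ⊆c _ (∈-fromList⁺ (P ++ Q) u∈)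
      covers : ∀ u → u ∈ₗ c
      covers u with ∈-resp-↭ (↭-sym (CutPair.perm cut)) (∈-allFin u)
      ... | here refl         = cut-visited cut cyc ⊆c′
      ... | there (here refl) = cut-visited (swap-pair cut) cyc ⊆c′
      ... | there (there u∈)  = ⊆c′ u∈

  -- The three outcomes of the Ore-type theorem applied to the graph without `v`.
  data Verdict (v : Fin n) : Set where
    forced   : (∀ X → HForce G X → v ∈ X) → Verdict v
    cutting  : ∀ {x P Q} → CutPair G v x P Q → Verdict v
    avoiding : ∀ {S} → Half G S → v ∉ S → Verdict v

  classify : 5 ≤ n → OTG G → ∀ v → Verdict v
  classify 5≤n otg v with complete {l = v ∷ []} ([] ∷ [])
  ... | W , perm with ↭-allFin-unique perm | ↭-allFin-length perm
  ... | v∉ ∷ uW | |W| = verdict (Arrangements.Ore.hamilton G W uW 3≤|W| ore)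
    where
    3≤|W| : 3 ≤ length W
    3≤|W| = ≤-trans (n≤1+n 3) (s≤s⁻¹ (subst (5 ≤_) (≡-sym |W|) 5≤n))
    open Arrangements G W uW 3≤|W|
    -- Deleting `v` costs each degree at most one, and `length W` is `n - 1`.
    ore : ∀ {a b} → a ∈ₗ W → b ∈ₗ W → a ≢ b → adj G a b ≡ false → length W ≤ suc (degᵂ a + degᵂ b)
    ore {a} {b} _ _ a≢b a≁b = ≤-by 0
      (≤-trans (≤-trans (≤-trans (≤-reflexive |W|) (otg a b a≢b a≁b))
                         (≤-reflexive (cong₂ _+_ (deg-↭ G a perm) (deg-↭ G b perm))))
               (+-mono-≤ (+-monoˡ-≤ (degᵂ a) (bit≤1 (adj G a v))) (+-monoˡ-≤ (degᵂ b) (bit≤1 (adj G b v)))))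
      (lem (length W) (degᵂ a) (degᵂ b))
      where
      lem : ∀ m p q → m + (1 + p + (1 + q)) + 0 ≡ suc (p + q) + suc m
      lem = solve-∀
    verdict : HamCycle ⊎ Structure → Verdict v
    verdict (inj₁ ham) = forced λ X force → member X force (v ∈? X)
      where
      member : ∀ X → HForce G X → Dec (v ∈ X) → v ∈ X
      member X force (yes v∈) = v∈
      member X force (no v∉X) = contradiction refl (All.lookup v∉ (ham-forces G W uW 3≤|W| force ham X⊆W v))
        where
        X⊆W : ∀ {x} → x ∈ X → x ∈ₗ W
        X⊆W {x} x∈ with ∈-resp-↭ (↭-sym perm) (∈-allFin x)
        ... | here refl = contradiction x∈ v∉X
        ... | there x∈W = x∈W
    verdict (inj₂ (cut-vertex x P Q p P≢[] Q≢[] sep)) =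
      cutting record { perm = ↭-trans (prep v p) perm ; P≢[] = P≢[] ; Q≢[] = Q≢[] ; sep = sep }
    verdict (inj₂ (independent I uI I⊆W indep size)) = avoiding
      (half (λ a b a∈ b∈ → indep (∈-fromList⁻ I a∈) (∈-fromList⁻ I b∈)) (≡-trans (cong (2 *_) (∣fromList∣ uI)) (≡-trans size |W|)))
      (λ v∈ → contradiction refl (All.lookup v∉ (All.lookup I⊆W (∈-fromList⁻ I v∈))))

  -- If both S and T are independent halves then G is balanced complete bipartite, and a cycle through
  -- all vertices but s and t exists because G − s − t satisfies Ore's condition.
  bipartite-forced : ∀ {S T X s t} → 5 ≤ n → OTG G → Half G S → (∀ {u} → u ∉ S → u ∈ T) →
                     Independent G T → HForce G X →
                     s ∈ S → s ∉ X → t ∈ T → t ∉ S → ¬ t ∉ X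
  bipartite-forced {S} {T} {X} {s} {t} 5≤n otg (half indep size) cover indepT force s∈ s∉X t∈ t∉S t∉X
    with complete {l = s ∷ t ∷ []} (((λ { refl → t∉S s∈ }) ∷ []) ∷ [] ∷ [])
  ... | W , perm with ↭-allFin-unique perm | ↭-allFin-length perm
  ... | (_ ∷ s∉) ∷ t∉ ∷ uW | |W| =
    impossible (Arrangements.Ore.hamilton G W uW 3≤|W| (λ _ _ ne e → ≤-trans (ore ne e) (n≤1+n _)))
    where
    3≤|W| : 3 ≤ length W
    3≤|W| = s≤s⁻¹ (s≤s⁻¹ (subst (5 ≤_) (≡-sym |W|) 5≤n))
    open Arrangements G W uW 3≤|W|
    -- A vertex of `S` is not joined to `s` and any other vertex is not joined to `t`, so each loses
    -- at most one neighbour.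
    lost : ∀ a → bit (adj G a s) + (bit (adj G a t) + degᵂ a) ≤ 1 + degᵂ a
    lost a with a ∈? S
    ... | yes a∈ = ≤-trans (≤-reflexive (cong (λ b → bit b + (bit (adj G a t) + degᵂ a)) (indep a s a∈ s∈)))
                           (+-monoˡ-≤ (degᵂ a) (bit≤1 (adj G a t)))
    ... | no a∉  = ≤-trans (≤-reflexive (cong (λ b → bit (adj G a s) + (bit b + degᵂ a)) (indepT a t (cover a∉) t∈)))
                           (+-monoˡ-≤ (degᵂ a) (bit≤1 (adj G a s)))
    ore : ∀ {a b} → a ≢ b → adj G a b ≡ false → length W ≤ degᵂ a + degᵂ b
    ore {a} {b} a≢b a≁b = ≤-by 0
      (≤-trans (≤-trans (≤-trans (≤-reflexive |W|) (otg a b a≢b a≁b))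
                         (≤-reflexive (cong₂ _+_ (deg-↭ G a perm) (deg-↭ G b perm))))
               (+-mono-≤ (lost a) (lost b)))
      (lem (length W) (degᵂ a) (degᵂ b))
      where
      lem : ∀ m p q → m + (1 + p + (1 + q)) + 0 ≡ p + q + suc (suc m)
      lem = solve-∀
    impossible : HamCycle ⊎ Structure → ⊥
    impossible (inj₁ ham) = All.lookup s∉ (ham-forces G W uW 3≤|W| force ham X⊆W s) refl
      where
      X⊆W : ∀ {x} → x ∈ X → x ∈ₗ W
      X⊆W {x} x∈ with ∈-resp-↭ (↭-sym perm) (∈-allFin x)
      ... | here refl         = contradiction x∈ s∉X
      ... | there (here refl) = contradiction x∈ t∉X
      ... | there (there x∈W) = x∈W
    -- Excluded by parity: `length W` is `n - 2`, which is even.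
    impossible (inj₂ (independent I _ _ _ size′)) =
      even≢odd ∣ S ∣ (length I) (≡-trans size (≡-trans (≡-sym |W|) (cong suc (≡-sym size′))))
    impossible (inj₂ (cut-vertex x P Q p P≢[] Q≢[] sep)) with nonempty-∈ P≢[] | nonempty-∈ Q≢[] | Unique-resp-↭ (↭-sym p) uW
    ... | a , a∈ | b , b∈ | _ ∷ uPQ = contradiction (ore (λ { refl → Unique-disjoint P uPQ a∈ b∈ }) (sep a∈ b∈)) (<⇒≱ small)
      where
      lem : ∀ p q c d → suc (p + q) + (1 + 0 + c + (1 + 0 + d)) + 0 ≡ suc (c + d) + (suc p + suc q)
      lem = solve-∀
      small : degᵂ a + degᵂ b < length W
      small = subst (degᵂ a + degᵂ b <_) (≡-trans (cong suc (≡-sym (length-++ P))) (↭-length p))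
        (≤-by 0 (+-mono-≤ (≤-trans (side-count G (x ∷ []) P Q (↭-sym p) a∈ (sep a∈))
                                   (+-monoˡ-≤ (length P) (+-monoˡ-≤ 0 (bit≤1 (adj G a x)))))
                          (≤-trans (side-count G (x ∷ []) Q P (↭-trans (↭-sym p) (prep x (++-comm P Q))) b∈
                                      (λ a∈ → adj-sym G (sep a∈ b∈)))
                                   (+-monoˡ-≤ (length Q) (+-monoˡ-≤ 0 (bit≤1 (adj G b x))))))
                (lem (degᵂ a) (degᵂ b) (length P) (length Q)))

-- Determination of the minimum H-force set.

module Minimum {n} (5≤n : 5 ≤ n) {G : Graph n} (otg : OTG G) {X : Subset n} (minimum : MinHForce G X)
               {H : Graph n} (closure : IsWeakClosure G H) where

  Conclusion : Set
  Conclusion = ((∣ X ∣ ≡ n ∸ 2) ⊎ ((2 * ∣ X ∣ ≡ n) ⊎ (∣ X ∣ ≡ n)))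
      × ((∣ X ∣ ≡ n ∸ 2 → Σ (Fin n) λ x → Σ (Fin n) λ y →
            x ≢ y × deg H x ≡ n ∸ 1 × deg H y ≡ n ∸ 1
            × (∀ v → (v ∈ X) ⇔ (v ≢ x × v ≢ y)))
        × ((2 * ∣ X ∣ ≡ n → LargestIndependent H X)
        × (∣ X ∣ ≡ n → ∀ v → v ∈ X)))

  forces : HForce G X
  forces = proj₁ minimum

  cut-in-H : ∀ {v x P Q} → CutPair G v x P Q → OTG H × CutPair H v x P Q
  cut-in-H {v} {x} {P} {Q} = closure-preserves (λ K → CutPair K v x P Q) (λ {K} {K′} st _ → step-cut {G = K} {K′} st)
                                               (proj₁ closure) otg

  half-in-H : ∀ {S} → Half G S → OTG H × Half H S
  half-in-H {S} = closure-preserves (λ K → Half K S) (λ {K} {K′} st _ → half-step {K = K} {K′} 5≤n st) (proj₁ closure) otg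

  -- The clauses of `Conclusion` are keyed on the cardinality of `X`, so each case has to refute the
  -- other two values.
  n≢n∸2 : n ≢ n ∸ 2
  n≢n∸2 e = <⇒≢ (∸-monoʳ-< {n} {2} {0} (s≤s z≤n) (≤-trans (s≤s (s≤s z≤n)) 5≤n)) (≡-sym e)

  double≢ : ∀ {k} → 2 * k ≡ n → k ≢ n
  double≢ {k} 2k≡n refl = <⇒≢ (m<m+n k (≤-trans (s≤s z≤n) (≤-trans 5≤n (≤-reflexive (≡-sym (+-identityʳ k)))))) (≡-sym 2k≡n)

  -- The two values coincide only for `k = 2` and `n = 4`.
  double≢∸2 : ∀ {k} → 2 * k ≡ n → k ≢ n ∸ 2
  double≢∸2 {k} 2k≡n k≡ = <⇒≱ 5≤n (≤-reflexive (≡-trans (≡-sym 2+k) (cong (2 +_) (≡-trans (≡-sym (+-identityʳ k)) k+0))))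
    where
    2+k : 2 + k ≡ n
    2+k = ≡-trans (cong (2 +_) k≡) (m+[n∸m]≡n (≤-trans (s≤s (s≤s z≤n)) 5≤n))
    k+0 : k + 0 ≡ 2
    k+0 = +-cancelˡ-≡ k (k + 0) 2 (≡-trans 2k≡n (≡-trans (≡-sym 2+k) (+-comm 2 k)))

  all-case : (∀ v → v ∈ X) → Conclusion
  all-case all = inj₂ (inj₂ size) , (λ e → contradiction (≡-trans (≡-sym size) e) n≢n∸2) ,
                 (λ e → contradiction size (double≢ e)) , λ _ → all
    where
    size : ∣ X ∣ ≡ n
    size = ≤-antisym (∣p∣≤n X) (subst (_≤ ∣ X ∣) (∣⊤∣≡n n) (p⊆q⇒∣p∣≤∣q∣ {p = ⊤} λ {v} _ → all v))

  -- `P ++ Q` is an H-force set and each of its vertices lies in every H-force set, so minimality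
  -- makes `X` equal to it.
  cut-case : ∀ {v x P Q} → CutPair G v x P Q → Conclusion
  cut-case {v} {x} {P} {Q} cut with cut-in-H cut
  ... | otgH , cutH =
    inj₁ size , (λ _ → v , x , v≢x , cut-apex-degree-full 5≤n otgH closed cutH ,
                       cut-apex-degree-full 5≤n otgH closed (swap-pair cutH) , λ u → mk⇔ (to u) (from u)) ,
    (λ e → contradiction size (double≢∸2 e)) , λ e → contradiction (≡-trans (≡-sym e) size) n≢n∸2
    where
    closed = proj₂ closure
    Y = fromList (P ++ Q)
    uV : Unique (v ∷ x ∷ P ++ Q)
    uV = ↭-allFin-unique (CutPair.perm cut)
    v≢x : v ≢ x
    v≢x with uV
    ... | (v≢x ∷ _) ∷ _ = v≢x
    meets : ∀ {w} → w ∈ₗ P ++ Q → ∃ λ u → u ≢ w × adj H w u ≡ false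
    meets w∈ with ∈-++⁻ P w∈ | nonempty-∈ (CutPair.P≢[] cut) | nonempty-∈ (CutPair.Q≢[] cut)
    ... | inj₁ w∈P | _ | q , q∈ = q , cut-distinct cut w∈P q∈ ∘ ≡-sym , CutPair.sep cutH w∈P q∈
    ... | inj₂ w∈Q | p , p∈ | _ = p , cut-distinct cut p∈ w∈Q , adj-sym H (CutPair.sep cutH p∈ w∈Q)
    Y⊆X : Y ⊆ X
    Y⊆X {w} w∈Y with classify 5≤n otg w
    ... | forced f       = f X forces
    ... | avoiding hf _  = contradiction cut (half-not-cut 5≤n hf otg)
    ... | cutting cut′ with cut-in-H cut′ | meets (∈-fromList⁻ (P ++ Q) w∈Y)
    -- An apex of a cut pair dominates the weak closure, but `w` keeps a nonneighbour on the other
    -- side.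
    ... | _ , cut′H | u , u≢w , w≁u = contradiction w≁u (true≢false (cut-apex-dominates 5≤n otgH closed cut′H u≢w))
    X≡Y : X ≡ Y
    X≡Y = ⊆-antisym (⊆∧∣≥∣⇒⊇ Y⊆X (proj₂ minimum Y (cut-HForce cut))) Y⊆X
    size : ∣ X ∣ ≡ n ∸ 2
    size with uV
    ... | _ ∷ _ ∷ u = ≡-trans (cong ∣_∣ X≡Y) (≡-trans (∣fromList∣ u) (cong (_∸ 2) (↭-allFin-length (CutPair.perm cut))))
    to : ∀ u → u ∈ X → u ≢ v × u ≢ x
    to u u∈ with ∈-fromList⁻ (P ++ Q) (subst (u ∈_) X≡Y u∈) | uV
    ... | u∈PQ | (_ ∷ v∉) ∷ x∉ ∷ _ = (λ u≡v → All.lookup v∉ u∈PQ (≡-sym u≡v)) , (λ u≡x → All.lookup x∉ u∈PQ (≡-sym u≡x))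
    from : ∀ u → u ≢ v × u ≢ x → u ∈ X
    from u (u≢v , u≢x) with ∈-resp-↭ (↭-sym (CutPair.perm cut)) (∈-allFin u)
    ... | here u≡v         = contradiction u≡v u≢v
    ... | there (here u≡x) = contradiction u≡x u≢x
    ... | there (there u∈) = Y⊆X (∈-fromList⁺ (P ++ Q) u∈)

  contained-half : ∀ {S} → Half G S → S ⊆ X → Conclusion
  contained-half {S} hf S⊆X = inj₂ (inj₁ size) , (λ e → contradiction e (double≢∸2 size)) ,
    (λ _ → subst (LargestIndependent H) (≡-sym X≡S) (half-largest 5≤n (proj₂ (half-in-H hf)) (proj₁ (half-in-H hf)))) ,
    λ e → contradiction e (double≢ size)
    where
    X≡S : X ≡ S
    X≡S = ⊆-antisym (⊆∧∣≥∣⇒⊇ S⊆X (proj₂ minimum S (half-HForce 5≤n hf))) S⊆X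
    size : 2 * ∣ X ∣ ≡ n
    size = ≡-trans (cong (λ T → 2 * ∣ T ∣) X≡S) (Half.size hf)

  missing : ∀ S → (∃ λ s → s ∈ S × s ∉ X) ⊎ S ⊆ X
  missing S with anyFin? (λ s → (s ∈? S) ×-dec ¬? (s ∈? X))
  ... | yes m = inj₁ m
  ... | no ¬m = inj₂ λ {s} s∈ → decidable-stable (s ∈? X) λ s∉ → ¬m (s , s∈ , s∉)

  -- A vertex `s` of `S` outside `X` can only be avoided by another half `T`, which turns out to be
  -- the complement of `S`. By `bipartite-forced`, `X` cannot miss a vertex from both classes.
  half-case : ∀ {S} → Half G S → Conclusion
  half-case {S} hf with missing S
  ... | inj₂ S⊆X = contained-half hf S⊆X
  ... | inj₁ (s , s∈ , s∉X) with classify 5≤n otg s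
  ... | forced f = contradiction (f X forces) s∉X
  ... | cutting cut = contradiction cut (half-not-cut 5≤n hf otg)
  ... | avoiding {T} hf′ s∉T with missing T
  ... | inj₂ T⊆X = contained-half hf′ T⊆X
  ... | inj₁ (t , t∈ , t∉X) = ⊥-elim (bipartite-forced 5≤n otg hf cover (Half.indep hf′) forces s∈ s∉X t∈ (T∩S t∈) t∉X)
    where
    -- Vertices of `T` are joined to everything outside `T`, in particular to `s`, whereas those of
    -- `S` are not joined to `s`.
    T∩S : ∀ {u} → u ∈ T → u ∉ S
    T∩S {u} u∈T u∈S = true≢false (half-joined 5≤n hf′ otg u∈T s∉T) (Half.indep hf u s u∈S s∈)
    ∣T∣≡∣S∣ : ∣ T ∣ ≡ ∣ S ∣
    ∣T∣≡∣S∣ = *-cancelˡ-≡ _ _ 2 (≡-trans (Half.size hf′) (≡-sym (Half.size hf)))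
    cover : ∀ {u} → u ∉ S → u ∈ T
    cover u∉S = ⊆∧∣≥∣⇒⊇ {p = T} (λ u∈ → x∉p⇒x∈∁p (T∩S u∈))
      (≤-reflexive (≡-trans (∣∁∣ S (Half.size hf)) (≡-sym ∣T∣≡∣S∣))) (x∉p⇒x∈∁p u∉S)

  conclusion : Conclusion
  conclusion with missing ⊤
  ... | inj₂ ⊤⊆X = all-case (λ v → ⊤⊆X ∈⊤)
  ... | inj₁ (v , _ , v∉X) with classify 5≤n otg v
  ... | forced f      = contradiction (f X forces) v∉X
  ... | cutting cut   = cut-case cut
  ... | avoiding hf _ = half-case hf

theorem2p2 : (n : ℕ) → 5 ≤ n → (G : Graph n) → OTG G → (X : Subset n) → MinHForce G X
    → (H : Graph n) → IsWeakClosure G H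
    → ((∣ X ∣ ≡ n ∸ 2) ⊎ ((2 * ∣ X ∣ ≡ n) ⊎ (∣ X ∣ ≡ n)))
      × ((∣ X ∣ ≡ n ∸ 2 → Σ (Fin n) λ x → Σ (Fin n) λ y →
            x ≢ y × deg H x ≡ n ∸ 1 × deg H y ≡ n ∸ 1
            × (∀ v → (v ∈ X) ⇔ (v ≢ x × v ≢ y)))
        × ((2 * ∣ X ∣ ≡ n → LargestIndependent H X)
        × (∣ X ∣ ≡ n → ∀ v → v ∈ X)))
theorem2p2 n 5≤n G otg X minimum H closure = Minimum.conclusion 5≤n otg minimum closure
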